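{- Let $s\geq 1$ be an integer. Then $$\mathrm{Aut}(\Gamma(\mathbb{Z}_{2^{s}}[i,j,k]))\cong \mathrm{Reg}(\Gamma(\mathbb{Z}_{2^{s}}[i,j,k]))\rtimes \mathrm{Aut}(\Gamma_{E}(\mathbb{Z}_{2^{s}}[i,j,k])).$$
   Context: $\mathbb{Z}_{2^s}[i,j,k]=\{a+bi+cj+dk\mid a,b,c,d\in\mathbb{Z}_{2^s}\}$ is the ring of Lipschitz quaternions modulo $2^s$, with the usual quaternion multiplication. For a ring $R$, $Z^*(R)$ is the set of non-zero zero divisors. The zero divisor graph $\Gamma(R)$ has vertex set $Z^*(R)$ with an edge $a\to b$ between distinct vertices $a,b$ if and only if $ab=0$. The ring $\mathbb{Z}_{2^s}[i,j,k]$ is reversible ($ab=0$ implies $ba=0$), so $\Gamma=\Gamma(\mathbb{Z}_{2^s}[i,j,k])$ can be regarded as an undirected graph. $\mathrm{Aut}$ denotes the group of graph automorphisms (adjacency-preserving and adjacency-reflecting bijections of the vertex set) under composition. For $a\in V(\Gamma)$, $N_r(a)=\{b\in V(\Gamma)\mid ab=0\}$ and $N_l(a)=\{b\in V(\Gamma)\mid ba=0\}$; $N(a)=N(b)$ means $N_r(a)=N_r(b)$ and $N_l(a)=N_l(b)$, and then $a,b$ are called twin points. A bijection $\varphi$ of $V(\Gamma)$ such that $\varphi(a)=b$ always implies that $a,b$ are twin points is an automorphism of $\Gamma$, called a regular automorphism; $\mathrm{Reg}(\Gamma)$ is the group of all regular automorphisms of $\Gamma$. Put $\bar a=\{b\in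 V(\Gamma)\mid a,b \text{ are twin points}\}$. The compressed graph $\Gamma_E=\Gamma_E(\mathbb{Z}_{2^s}[i,j,k])$ has vertex set $\{\bar a\mid a\in V(\Gamma)\}$, and distinct vertices $\bar a,\bar b$ are adjacent if and only if $a$ and $b$ are adjacent in $\Gamma$. -}

module Defs where

open import Algebra.Bundles using (CommutativeRing; Group; Ring)
open import Algebra.Morphism.Structures using (IsGroupIsomorphism)
import Algebra.Properties.Group as GroupProperties
import Data.Integer.Base as Int
open Int using (ℤ; 0ℤ; 1ℤ)
open import Data.Integer.Divisibility.Signed
  using (_∣_; divides; ∣m⇒∣-m; ∣m∣n⇒∣m+n; ∣n⇒∣m*n)
import Data.Integer.Properties as ℤₚ
open import Data.Integer.Tactic.RingSolver using (solve-∀)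
open import Data.Nat.Base using (ℕ)
open import Data.Product.Base using (_×_; _,_; proj₁; proj₂; ∃; Σ-syntax)
open import Data.Product.Relation.Binary.Pointwise.NonDependent using (Pointwise; ×-isEquivalence)
open import Data.Sum.Base using (_⊎_)
open import Function.Bundles using (Inverse)
import Function.Construct.Composition as Composition
import Function.Construct.Identity as Identity
import Function.Construct.Symmetry as Symmetry
open import Level using (Level; 0ℓ; _⊔_; suc)
open import Relation.Binary.Bundles using (Setoid)
open import Relation.Binary.Structures using (IsEquivalence)
open import Relation.Binary.Core using (Rel)
open import Relation.Binary.Definitions using (_Respects₂_)
import Relation.Binary.Construct.On as On
open import Relation.Binary.PropositionalEquality.Core as ≡ using (_≡_; subst)
open import Relation.Nullary.Negation.Core using (¬_)
open import Relation.Unary using (Pred; _≐_)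
open import Relation.Unary.Properties using (≐-refl; ≐-sym; ≐-trans)

private
  variable
    c ℓ e c₁ ℓ₁ c₂ ℓ₂ : Level

------------------------------------------------------------------------
-- ℤ/nℤ: the integers, with congruence modulo n as equality.

module Modular (n : ℕ) where

  open Int using (+_; -_; _+_; _-_; _*_)

  infix 4 _≈ₙ_

  -- A record, so that x and y can be inferred from the type x ≈ₙ y.
  record _≈ₙ_ (x y : ℤ) : Set where
    constructor congruent
    field
      n∣x-y : + n ∣ x - y

  ≡⇒≈ₙ : ∀ {x y} → x ≡ y → x ≈ₙ y
  ≡⇒≈ₙ {x} ≡.refl = congruent (subst (+ n ∣_) (≡.sym (ℤₚ.+-inverseʳ x)) (divides 0ℤ ≡.refl))

  private
    symₙ : ∀ {x y} → x ≈ₙ y → y ≈ₙ x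
    symₙ {x} {y} (congruent p) = congruent (subst (+ n ∣_) (lemma x y) (∣m⇒∣-m p))
      where
      lemma : ∀ x y → - (x - y) ≡ y - x
      lemma = solve-∀

    transₙ : ∀ {x y z} → x ≈ₙ y → y ≈ₙ z → x ≈ₙ z
    transₙ {x} {y} {z} (congruent p) (congruent q) =
      congruent (subst (+ n ∣_) (lemma x y z) (∣m∣n⇒∣m+n p q))
      where
      lemma : ∀ x y z → (x - y) + (y - z) ≡ x - z
      lemma = solve-∀

    +-congₙ : ∀ {x x′ y y′} → x ≈ₙ x′ → y ≈ₙ y′ → x + y ≈ₙ x′ + y′
    +-congₙ {x} {x′} {y} {y′} (congruent p) (congruent q) =
      congruent (subst (+ n ∣_) (lemma x x′ y y′) (∣m∣n⇒∣m+n p q))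
      where
      lemma : ∀ x x′ y y′ → (x - x′) + (y - y′) ≡ (x + y) - (x′ + y′)
      lemma = solve-∀

    -‿congₙ : ∀ {x x′} → x ≈ₙ x′ → - x ≈ₙ - x′
    -‿congₙ {x} {x′} (congruent p) =
      congruent (subst (+ n ∣_) (lemma x x′) (∣m⇒∣-m p))
      where
      lemma : ∀ x x′ → - (x - x′) ≡ - x - (- x′)
      lemma = solve-∀

    *-congₙ : ∀ {x x′ y y′} → x ≈ₙ x′ → y ≈ₙ y′ → x * y ≈ₙ x′ * y′
    *-congₙ {x} {x′} {y} {y′} (congruent p) (congruent q) =
      congruent (subst (+ n ∣_) (lemma x x′ y y′)
        (∣m∣n⇒∣m+n (∣n⇒∣m*n y p) (∣n⇒∣m*n x′ q)))
      where
      lemma : ∀ x x′ y y′ →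
              y * (x - x′) + x′ * (y - y′) ≡ x * y - x′ * y′
      lemma = solve-∀

  commutativeRing : CommutativeRing 0ℓ 0ℓ
  commutativeRing = record
    { Carrier = ℤ
    ; _≈_     = _≈ₙ_
    ; _+_     = _+_
    ; _*_     = _*_
    ; -_      = -_
    ; 0#      = 0ℤ
    ; 1#      = 1ℤ
    ; isCommutativeRing = record
      { isRing = record
        { +-isAbelianGroup = record
          { isGroup = record
            { isMonoid = record
              { isSemigroup = record
                { isMagma = record
                  { isEquivalence = record
                    { refl  = ≡⇒≈ₙ ≡.refl
                    ; sym   = symₙ
                    ; trans = transₙ
                    }
                  ; ∙-cong = +-congₙ
                  }
                ; assoc = λ x y z → ≡⇒≈ₙ (ℤₚ.+-assoc x y z)
                }
              ; identity = (λ x → ≡⇒≈ₙ (ℤₚ.+-identityˡ x))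
                         , (λ x → ≡⇒≈ₙ (ℤₚ.+-identityʳ x))
              }
            ; inverse = (λ x → ≡⇒≈ₙ (ℤₚ.+-inverseˡ x))
                      , (λ x → ≡⇒≈ₙ (ℤₚ.+-inverseʳ x))
            ; ⁻¹-cong = -‿congₙ
            }
          ; comm = λ x y → ≡⇒≈ₙ (ℤₚ.+-comm x y)
          }
        ; *-cong     = *-congₙ
        ; *-assoc    = λ x y z → ≡⇒≈ₙ (ℤₚ.*-assoc x y z)
        ; *-identity = (λ x → ≡⇒≈ₙ (ℤₚ.*-identityˡ x))
                     , (λ x → ≡⇒≈ₙ (ℤₚ.*-identityʳ x))
        ; distrib    = (λ x y z → ≡⇒≈ₙ (ℤₚ.*-distribˡ-+ x y z))
                     , (λ x y z → ≡⇒≈ₙ (ℤₚ.*-distribʳ-+ x y z))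
        }
      ; *-comm = λ x y → ≡⇒≈ₙ (ℤₚ.*-comm x y)
      }
    }

ℤ/ : ℕ → CommutativeRing 0ℓ 0ℓ
ℤ/ n = Modular.commutativeRing n

------------------------------------------------------------------------
-- Quaternions a + bi + cj + dk over a commutative ring.

record Quaternion (A : Set c) : Set c where
  constructor quat
  field
    re im-i im-j im-k : A

module QuaternionOperations (K : CommutativeRing c ℓ) where

  private
    module K = CommutativeRing K
    ℍ = Quaternion K.Carrier

  open K using (0#; 1#) renaming (_+_ to _+ₖ_; _*_ to _*ₖ_; _-_ to _-ₖ_; -_ to -ₖ_)
  open Quaternion

  infix  4 _≋_
  infixl 6 _⊕_
  infixl 7 _⊛_
  infix  8 ⊖_

  record _≋_ (x y : ℍ) : Set ℓ where
    constructor quat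
    field
      re≈   : re   x K.≈ re   y
      im-i≈ : im-i x K.≈ im-i y
      im-j≈ : im-j x K.≈ im-j y
      im-k≈ : im-k x K.≈ im-k y

  0ℍ 1ℍ : ℍ
  0ℍ = quat 0# 0# 0# 0#
  1ℍ = quat 1# 0# 0# 0#

  ⊖_ : ℍ → ℍ
  ⊖ quat a b c d = quat (-ₖ a) (-ₖ b) (-ₖ c) (-ₖ d)

  _⊕_ : ℍ → ℍ → ℍ
  quat a b c d ⊕ quat a′ b′ c′ d′ =
    quat (a +ₖ a′) (b +ₖ b′) (c +ₖ c′) (d +ₖ d′)

  -- i² = j² = k² = -1, ij = k = -ji, jk = i = -kj, ki = j = -ik.
  _⊛_ : ℍ → ℍ → ℍ
  quat a b c d ⊛ quat a′ b′ c′ d′ = quat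
    (a *ₖ a′ -ₖ b *ₖ b′ -ₖ c *ₖ c′ -ₖ d *ₖ d′)
    (a *ₖ b′ +ₖ b *ₖ a′ +ₖ c *ₖ d′ -ₖ d *ₖ c′)
    (a *ₖ c′ -ₖ b *ₖ d′ +ₖ c *ₖ a′ +ₖ d *ₖ b′)
    (a *ₖ d′ +ₖ b *ₖ c′ -ₖ c *ₖ b′ +ₖ d *ₖ a′)

  ≋-isEquivalence : IsEquivalence _≋_
  ≋-isEquivalence = record
    { refl  = quat K.refl K.refl K.refl K.refl
    ; sym   = λ { (quat p q r s) → quat (K.sym p) (K.sym q) (K.sym r) (K.sym s) }
    ; trans = λ { (quat p q r s) (quat p′ q′ r′ s′) →
        quat (K.trans p p′) (K.trans q q′) (K.trans r r′) (K.trans s s′) }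
    }

  ⊖-cong : ∀ {x y} → x ≋ y → ⊖ x ≋ ⊖ y
  ⊖-cong (quat p q r s) =
    quat (K.-‿cong p) (K.-‿cong q) (K.-‿cong r) (K.-‿cong s)

  ⊕-cong : ∀ {x x′ y y′} → x ≋ x′ → y ≋ y′ → x ⊕ y ≋ x′ ⊕ y′
  ⊕-cong (quat p q r s) (quat p′ q′ r′ s′) =
    quat (K.+-cong p p′) (K.+-cong q q′) (K.+-cong r r′) (K.+-cong s s′)

  ⊛-cong : ∀ {x x′ y y′} → x ≋ x′ → y ≋ y′ → x ⊛ y ≋ x′ ⊛ y′
  ⊛-cong (quat p q r s) (quat p′ q′ r′ s′) = quat
    (((p · p′) ∸ (q · q′)) ∸ (r · r′) ∸ (s · s′))
    (((p · q′) ∔ (q · p′)) ∔ (r · s′) ∸ (s · r′))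
    (((p · r′) ∸ (q · s′)) ∔ (r · p′) ∔ (s · q′))
    (((p · s′) ∔ (q · r′)) ∸ (r · q′) ∔ (s · p′))
    where
    infixl 6 _∔_ _∸_
    infixl 7 _·_
    _·_ : ∀ {x x′ y y′} → x K.≈ x′ → y K.≈ y′ → x *ₖ y K.≈ x′ *ₖ y′
    _·_ = K.*-cong
    _∔_ : ∀ {x x′ y y′} → x K.≈ x′ → y K.≈ y′ → x +ₖ y K.≈ x′ +ₖ y′
    _∔_ = K.+-cong
    _∸_ : ∀ {x x′ y y′} → x K.≈ x′ → y K.≈ y′ → x -ₖ y K.≈ x′ -ₖ y′
    p ∸ q = K.+-cong p (K.-‿cong q)

------------------------------------------------------------------------
-- ℤₙ[i,j,k], the ring of Lipschitz quaternions modulo n.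

module Lipschitz (n : ℕ) where

  open Int using (_+_; _-_; _*_)
  open QuaternionOperations (ℤ/ n)
  open Modular n using (≡⇒≈ₙ)

  private
    ℍ = Quaternion ℤ

    ≡⇒≋ : ∀ {a b c d a′ b′ c′ d′} → a ≡ a′ → b ≡ b′ → c ≡ c′ → d ≡ d′ →
          quat a b c d ≋ quat a′ b′ c′ d′
    ≡⇒≋ p q r s = quat (≡⇒≈ₙ p) (≡⇒≈ₙ q) (≡⇒≈ₙ r) (≡⇒≈ₙ s)

    ⊛-assoc : ∀ x y z → (x ⊛ y) ⊛ z ≋ x ⊛ (y ⊛ z)
    ⊛-assoc (quat a₀ a₁ a₂ a₃) (quat b₀ b₁ b₂ b₃) (quat c₀ c₁ c₂ c₃) = ≡⇒≋
      (law0 a₀ a₁ a₂ a₃ b₀ b₁ b₂ b₃ c₀ c₁ c₂ c₃)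
      (law1 a₀ a₁ a₂ a₃ b₀ b₁ b₂ b₃ c₀ c₁ c₂ c₃)
      (law2 a₀ a₁ a₂ a₃ b₀ b₁ b₂ b₃ c₀ c₁ c₂ c₃)
      (law3 a₀ a₁ a₂ a₃ b₀ b₁ b₂ b₃ c₀ c₁ c₂ c₃)
      where
      law0 : ∀ a₀ a₁ a₂ a₃ b₀ b₁ b₂ b₃ c₀ c₁ c₂ c₃ →
             (a₀ * b₀ - a₁ * b₁ - a₂ * b₂ - a₃ * b₃) * c₀ - (a₀ * b₁ + a₁ * b₀ + a₂ * b₃ - a₃ * b₂) * c₁ - (a₀ * b₂ - a₁ * b₃ + a₂ * b₀ + a₃ * b₁) * c₂ - (a₀ * b₃ + a₁ * b₂ - a₂ * b₁ + a₃ * b₀) * c₃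
             ≡ a₀ * (b₀ * c₀ - b₁ * c₁ - b₂ * c₂ - b₃ * c₃) - a₁ * (b₀ * c₁ + b₁ * c₀ + b₂ * c₃ - b₃ * c₂) - a₂ * (b₀ * c₂ - b₁ * c₃ + b₂ * c₀ + b₃ * c₁) - a₃ * (b₀ * c₃ + b₁ * c₂ - b₂ * c₁ + b₃ * c₀)
      law0 = solve-∀
      law1 : ∀ a₀ a₁ a₂ a₃ b₀ b₁ b₂ b₃ c₀ c₁ c₂ c₃ →
             (a₀ * b₀ - a₁ * b₁ - a₂ * b₂ - a₃ * b₃) * c₁ + (a₀ * b₁ + a₁ * b₀ + a₂ * b₃ - a₃ * b₂) * c₀ + (a₀ * b₂ - a₁ * b₃ + a₂ * b₀ + a₃ * b₁) * c₃ - (a₀ * b₃ + a₁ * b₂ - a₂ * b₁ + a₃ * b₀) * c₂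
             ≡ a₀ * (b₀ * c₁ + b₁ * c₀ + b₂ * c₃ - b₃ * c₂) + a₁ * (b₀ * c₀ - b₁ * c₁ - b₂ * c₂ - b₃ * c₃) + a₂ * (b₀ * c₃ + b₁ * c₂ - b₂ * c₁ + b₃ * c₀) - a₃ * (b₀ * c₂ - b₁ * c₃ + b₂ * c₀ + b₃ * c₁)
      law1 = solve-∀
      law2 : ∀ a₀ a₁ a₂ a₃ b₀ b₁ b₂ b₃ c₀ c₁ c₂ c₃ →
             (a₀ * b₀ - a₁ * b₁ - a₂ * b₂ - a₃ * b₃) * c₂ - (a₀ * b₁ + a₁ * b₀ + a₂ * b₃ - a₃ * b₂) * c₃ + (a₀ * b₂ - a₁ * b₃ + a₂ * b₀ + a₃ * b₁) * c₀ + (a₀ * b₃ + a₁ * b₂ - a₂ * b₁ + a₃ * b₀) * c₁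
             ≡ a₀ * (b₀ * c₂ - b₁ * c₃ + b₂ * c₀ + b₃ * c₁) - a₁ * (b₀ * c₃ + b₁ * c₂ - b₂ * c₁ + b₃ * c₀) + a₂ * (b₀ * c₀ - b₁ * c₁ - b₂ * c₂ - b₃ * c₃) + a₃ * (b₀ * c₁ + b₁ * c₀ + b₂ * c₃ - b₃ * c₂)
      law2 = solve-∀
      law3 : ∀ a₀ a₁ a₂ a₃ b₀ b₁ b₂ b₃ c₀ c₁ c₂ c₃ →
             (a₀ * b₀ - a₁ * b₁ - a₂ * b₂ - a₃ * b₃) * c₃ + (a₀ * b₁ + a₁ * b₀ + a₂ * b₃ - a₃ * b₂) * c₂ - (a₀ * b₂ - a₁ * b₃ + a₂ * b₀ + a₃ * b₁) * c₁ + (a₀ * b₃ + a₁ * b₂ - a₂ * b₁ + a₃ * b₀) * c₀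
             ≡ a₀ * (b₀ * c₃ + b₁ * c₂ - b₂ * c₁ + b₃ * c₀) + a₁ * (b₀ * c₂ - b₁ * c₃ + b₂ * c₀ + b₃ * c₁) - a₂ * (b₀ * c₁ + b₁ * c₀ + b₂ * c₃ - b₃ * c₂) + a₃ * (b₀ * c₀ - b₁ * c₁ - b₂ * c₂ - b₃ * c₃)
      law3 = solve-∀

    ⊛-identityˡ : ∀ x → 1ℍ ⊛ x ≋ x
    ⊛-identityˡ (quat a₀ a₁ a₂ a₃) = ≡⇒≋
      (law0 a₀ a₁ a₂ a₃)
      (law1 a₀ a₁ a₂ a₃)
      (law2 a₀ a₁ a₂ a₃)
      (law3 a₀ a₁ a₂ a₃)
      where
      law0 : ∀ a₀ a₁ a₂ a₃ →
             1ℤ * a₀ - 0ℤ * a₁ - 0ℤ * a₂ - 0ℤ * a₃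
             ≡ a₀
      law0 = solve-∀
      law1 : ∀ a₀ a₁ a₂ a₃ →
             1ℤ * a₁ + 0ℤ * a₀ + 0ℤ * a₃ - 0ℤ * a₂
             ≡ a₁
      law1 = solve-∀
      law2 : ∀ a₀ a₁ a₂ a₃ →
             1ℤ * a₂ - 0ℤ * a₃ + 0ℤ * a₀ + 0ℤ * a₁
             ≡ a₂
      law2 = solve-∀
      law3 : ∀ a₀ a₁ a₂ a₃ →
             1ℤ * a₃ + 0ℤ * a₂ - 0ℤ * a₁ + 0ℤ * a₀
             ≡ a₃
      law3 = solve-∀

    ⊛-identityʳ : ∀ x → x ⊛ 1ℍ ≋ x
    ⊛-identityʳ (quat a₀ a₁ a₂ a₃) = ≡⇒≋
      (law0 a₀ a₁ a₂ a₃)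
      (law1 a₀ a₁ a₂ a₃)
      (law2 a₀ a₁ a₂ a₃)
      (law3 a₀ a₁ a₂ a₃)
      where
      law0 : ∀ a₀ a₁ a₂ a₃ →
             a₀ * 1ℤ - a₁ * 0ℤ - a₂ * 0ℤ - a₃ * 0ℤ
             ≡ a₀
      law0 = solve-∀
      law1 : ∀ a₀ a₁ a₂ a₃ →
             a₀ * 0ℤ + a₁ * 1ℤ + a₂ * 0ℤ - a₃ * 0ℤ
             ≡ a₁
      law1 = solve-∀
      law2 : ∀ a₀ a₁ a₂ a₃ →
             a₀ * 0ℤ - a₁ * 0ℤ + a₂ * 1ℤ + a₃ * 0ℤ
             ≡ a₂
      law2 = solve-∀
      law3 : ∀ a₀ a₁ a₂ a₃ →
             a₀ * 0ℤ + a₁ * 0ℤ - a₂ * 0ℤ + a₃ * 1ℤ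
             ≡ a₃
      law3 = solve-∀

    ⊛-distribˡ-⊕ : ∀ x y z → x ⊛ (y ⊕ z) ≋ (x ⊛ y) ⊕ (x ⊛ z)
    ⊛-distribˡ-⊕ (quat a₀ a₁ a₂ a₃) (quat b₀ b₁ b₂ b₃) (quat c₀ c₁ c₂ c₃) = ≡⇒≋
      (law0 a₀ a₁ a₂ a₃ b₀ b₁ b₂ b₃ c₀ c₁ c₂ c₃)
      (law1 a₀ a₁ a₂ a₃ b₀ b₁ b₂ b₃ c₀ c₁ c₂ c₃)
      (law2 a₀ a₁ a₂ a₃ b₀ b₁ b₂ b₃ c₀ c₁ c₂ c₃)
      (law3 a₀ a₁ a₂ a₃ b₀ b₁ b₂ b₃ c₀ c₁ c₂ c₃)
      where
      law0 : ∀ a₀ a₁ a₂ a₃ b₀ b₁ b₂ b₃ c₀ c₁ c₂ c₃ →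
             a₀ * (b₀ + c₀) - a₁ * (b₁ + c₁) - a₂ * (b₂ + c₂) - a₃ * (b₃ + c₃)
             ≡ (a₀ * b₀ - a₁ * b₁ - a₂ * b₂ - a₃ * b₃) + (a₀ * c₀ - a₁ * c₁ - a₂ * c₂ - a₃ * c₃)
      law0 = solve-∀
      law1 : ∀ a₀ a₁ a₂ a₃ b₀ b₁ b₂ b₃ c₀ c₁ c₂ c₃ →
             a₀ * (b₁ + c₁) + a₁ * (b₀ + c₀) + a₂ * (b₃ + c₃) - a₃ * (b₂ + c₂)
             ≡ (a₀ * b₁ + a₁ * b₀ + a₂ * b₃ - a₃ * b₂) + (a₀ * c₁ + a₁ * c₀ + a₂ * c₃ - a₃ * c₂)
      law1 = solve-∀
      law2 : ∀ a₀ a₁ a₂ a₃ b₀ b₁ b₂ b₃ c₀ c₁ c₂ c₃ →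
             a₀ * (b₂ + c₂) - a₁ * (b₃ + c₃) + a₂ * (b₀ + c₀) + a₃ * (b₁ + c₁)
             ≡ (a₀ * b₂ - a₁ * b₃ + a₂ * b₀ + a₃ * b₁) + (a₀ * c₂ - a₁ * c₃ + a₂ * c₀ + a₃ * c₁)
      law2 = solve-∀
      law3 : ∀ a₀ a₁ a₂ a₃ b₀ b₁ b₂ b₃ c₀ c₁ c₂ c₃ →
             a₀ * (b₃ + c₃) + a₁ * (b₂ + c₂) - a₂ * (b₁ + c₁) + a₃ * (b₀ + c₀)
             ≡ (a₀ * b₃ + a₁ * b₂ - a₂ * b₁ + a₃ * b₀) + (a₀ * c₃ + a₁ * c₂ - a₂ * c₁ + a₃ * c₀)
      law3 = solve-∀

    ⊛-distribʳ-⊕ : ∀ x y z → (y ⊕ z) ⊛ x ≋ (y ⊛ x) ⊕ (z ⊛ x)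
    ⊛-distribʳ-⊕ (quat a₀ a₁ a₂ a₃) (quat b₀ b₁ b₂ b₃) (quat c₀ c₁ c₂ c₃) = ≡⇒≋
      (law0 a₀ a₁ a₂ a₃ b₀ b₁ b₂ b₃ c₀ c₁ c₂ c₃)
      (law1 a₀ a₁ a₂ a₃ b₀ b₁ b₂ b₃ c₀ c₁ c₂ c₃)
      (law2 a₀ a₁ a₂ a₃ b₀ b₁ b₂ b₃ c₀ c₁ c₂ c₃)
      (law3 a₀ a₁ a₂ a₃ b₀ b₁ b₂ b₃ c₀ c₁ c₂ c₃)
      where
      law0 : ∀ a₀ a₁ a₂ a₃ b₀ b₁ b₂ b₃ c₀ c₁ c₂ c₃ →
             (b₀ + c₀) * a₀ - (b₁ + c₁) * a₁ - (b₂ + c₂) * a₂ - (b₃ + c₃) * a₃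
             ≡ (b₀ * a₀ - b₁ * a₁ - b₂ * a₂ - b₃ * a₃) + (c₀ * a₀ - c₁ * a₁ - c₂ * a₂ - c₃ * a₃)
      law0 = solve-∀
      law1 : ∀ a₀ a₁ a₂ a₃ b₀ b₁ b₂ b₃ c₀ c₁ c₂ c₃ →
             (b₀ + c₀) * a₁ + (b₁ + c₁) * a₀ + (b₂ + c₂) * a₃ - (b₃ + c₃) * a₂
             ≡ (b₀ * a₁ + b₁ * a₀ + b₂ * a₃ - b₃ * a₂) + (c₀ * a₁ + c₁ * a₀ + c₂ * a₃ - c₃ * a₂)
      law1 = solve-∀
      law2 : ∀ a₀ a₁ a₂ a₃ b₀ b₁ b₂ b₃ c₀ c₁ c₂ c₃ →
             (b₀ + c₀) * a₂ - (b₁ + c₁) * a₃ + (b₂ + c₂) * a₀ + (b₃ + c₃) * a₁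
             ≡ (b₀ * a₂ - b₁ * a₃ + b₂ * a₀ + b₃ * a₁) + (c₀ * a₂ - c₁ * a₃ + c₂ * a₀ + c₃ * a₁)
      law2 = solve-∀
      law3 : ∀ a₀ a₁ a₂ a₃ b₀ b₁ b₂ b₃ c₀ c₁ c₂ c₃ →
             (b₀ + c₀) * a₃ + (b₁ + c₁) * a₂ - (b₂ + c₂) * a₁ + (b₃ + c₃) * a₀
             ≡ (b₀ * a₃ + b₁ * a₂ - b₂ * a₁ + b₃ * a₀) + (c₀ * a₃ + c₁ * a₂ - c₂ * a₁ + c₃ * a₀)
      law3 = solve-∀

  ring : Ring 0ℓ 0ℓ
  ring = record
    { Carrier = ℍ
    ; _≈_     = _≋_
    ; _+_     = _⊕_
    ; _*_     = _⊛_
    ; -_      = ⊖_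
    ; 0#      = 0ℍ
    ; 1#      = 1ℍ
    ; isRing  = record
      { +-isAbelianGroup = record
        { isGroup = record
          { isMonoid = record
            { isSemigroup = record
              { isMagma = record
                { isEquivalence = ≋-isEquivalence
                ; ∙-cong        = ⊕-cong
                }
              ; assoc = λ { (quat a b c d) (quat a′ b′ c′ d′) (quat a″ b″ c″ d″) →
                  ≡⇒≋ (ℤₚ.+-assoc a a′ a″) (ℤₚ.+-assoc b b′ b″)
                      (ℤₚ.+-assoc c c′ c″) (ℤₚ.+-assoc d d′ d″) }
              }
            ; identity =
                (λ { (quat a b c d) → ≡⇒≋ (ℤₚ.+-identityˡ a) (ℤₚ.+-identityˡ b)
                                          (ℤₚ.+-identityˡ c) (ℤₚ.+-identityˡ d) })
              , (λ { (quat a b c d) → ≡⇒≋ (ℤₚ.+-identityʳ a) (ℤₚ.+-identityʳ b)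
                                          (ℤₚ.+-identityʳ c) (ℤₚ.+-identityʳ d) })
            }
          ; inverse =
              (λ { (quat a b c d) → ≡⇒≋ (ℤₚ.+-inverseˡ a) (ℤₚ.+-inverseˡ b)
                                        (ℤₚ.+-inverseˡ c) (ℤₚ.+-inverseˡ d) })
            , (λ { (quat a b c d) → ≡⇒≋ (ℤₚ.+-inverseʳ a) (ℤₚ.+-inverseʳ b)
                                        (ℤₚ.+-inverseʳ c) (ℤₚ.+-inverseʳ d) })
          ; ⁻¹-cong = ⊖-cong
          }
        ; comm = λ { (quat a b c d) (quat a′ b′ c′ d′) →
            ≡⇒≋ (ℤₚ.+-comm a a′) (ℤₚ.+-comm b b′) (ℤₚ.+-comm c c′) (ℤₚ.+-comm d d′) }
        }
      ; *-cong     = ⊛-cong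
      ; *-assoc    = ⊛-assoc
      ; *-identity = ⊛-identityˡ , ⊛-identityʳ
      ; distrib    = ⊛-distribˡ-⊕ , ⊛-distribʳ-⊕
      }
    }

ℤ/_[i,j,k] : ℕ → Ring 0ℓ 0ℓ
ℤ/ n [i,j,k] = Lipschitz.ring n

------------------------------------------------------------------------
-- Directed graphs and their automorphism groups.

record Digraph c ℓ e : Set (suc (c ⊔ ℓ ⊔ e)) where
  infix 4 _⟶_
  field
    vertices : Setoid c ℓ
  open Setoid vertices public renaming (Carrier to Vertex)
  field
    _⟶_    : Rel Vertex e
    ⟶-resp : _⟶_ Respects₂ _≈_

module _ (G : Digraph c ℓ e) where

  open Digraph G

  record Automorphism : Set (c ⊔ ℓ ⊔ e) where
    field
      bijection : Inverse vertices vertices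
    open Inverse bijection public
    field
      preserves : ∀ {a b} → a ⟶ b → to a ⟶ to b
      reflects  : ∀ {a b} → to a ⟶ to b → a ⟶ b

  open Automorphism

  private
    id-aut : Automorphism
    id-aut = record
      { bijection = Identity.inverse vertices
      ; preserves = λ p → p
      ; reflects  = λ p → p
      }

    _∘-aut_ : Automorphism → Automorphism → Automorphism
    φ ∘-aut ψ = record
      { bijection = Composition.inverse (bijection ψ) (bijection φ)
      ; preserves = λ p → preserves φ (preserves ψ p)
      ; reflects  = λ p → reflects ψ (reflects φ p)
      }

    inv-aut : Automorphism → Automorphism
    inv-aut φ = record
      { bijection = Symmetry.inverse (bijection φ)
      ; preserves = λ p → reflects φ
          (⟶-transport (sym (strictlyInverseˡ φ _)) (sym (strictlyInverseˡ φ _)) p)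
      ; reflects  = λ p →
          ⟶-transport (strictlyInverseˡ φ _) (strictlyInverseˡ φ _) (preserves φ p)
      }
      where
      ⟶-transport : ∀ {a a′ b b′} → a ≈ a′ → b ≈ b′ → a ⟶ b → a′ ⟶ b′
      ⟶-transport p q r = proj₁ ⟶-resp q (proj₂ ⟶-resp p r)

  Aut : Group (c ⊔ ℓ ⊔ e) (c ⊔ ℓ)
  Aut = record
    { Carrier = Automorphism
    ; _≈_     = λ φ ψ → ∀ a → to φ a ≈ to ψ a
    ; _∙_     = _∘-aut_
    ; ε       = id-aut
    ; _⁻¹     = inv-aut
    ; isGroup = record
      { isMonoid = record
        { isSemigroup = record
          { isMagma = record
            { isEquivalence = record
              { refl  = λ _ → refl
              ; sym   = λ p a → sym (p a)
              ; trans = λ p q a → trans (p a) (q a)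
              }
            ; ∙-cong = λ {φ} {_} {_} {ψ′} p q a → trans (to-cong φ (q a)) (p (to ψ′ a))
            }
          ; assoc = λ _ _ _ _ → refl
          }
        ; identity = (λ _ _ → refl) , (λ _ _ → refl)
        }
      ; inverse = strictlyInverseʳ , strictlyInverseˡ
      ; ⁻¹-cong = λ {φ} {ψ} p a → trans
          (from-cong φ (trans (sym (strictlyInverseˡ ψ a)) (sym (p (from ψ a)))))
          (strictlyInverseʳ φ (from ψ a))
      }
    }

------------------------------------------------------------------------
-- The zero divisor graph of a ring, its regular automorphisms and its
-- compressed graph.

module ZeroDivisorGraph (R : Ring c ℓ) where

  open Ring R renaming (refl to ≈-refl; sym to ≈-sym; trans to ≈-trans)

  IsZeroDivisor : Pred Carrier (c ⊔ ℓ)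
  IsZeroDivisor a = ∃ λ b → ¬ b ≈ 0# × (a * b ≈ 0# ⊎ b * a ≈ 0#)

  Z* : Set (c ⊔ ℓ)
  Z* = Σ[ a ∈ Carrier ] ¬ a ≈ 0# × IsZeroDivisor a

  -- Vertices are compared as ring elements, ignoring the proofs.
  Z*-setoid : Setoid (c ⊔ ℓ) ℓ
  Z*-setoid = On.setoid {B = Z*} setoid proj₁

  open Setoid Z*-setoid using () renaming (_≈_ to _≈ᵥ_)

  Annihilates : Rel Z* ℓ
  Annihilates (a , _) (b , _) = a * b ≈ 0#

  Annihilates-resp : ∀ {a a′ b b′} → a ≈ᵥ a′ → b ≈ᵥ b′ → Annihilates a b → Annihilates a′ b′
  Annihilates-resp p q ab≈0 = ≈-trans (*-cong (≈-sym p) (≈-sym q)) ab≈0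

  -- Directed, with no symmetry built in; undirected when R is reversible.
  Γ : Digraph (c ⊔ ℓ) ℓ ℓ
  Γ = record
    { vertices = Z*-setoid
    ; _⟶_      = λ a b → ¬ a ≈ᵥ b × Annihilates a b
    ; ⟶-resp   =
        (λ {a} {b} {b′} p (a≉b , ab≈0) →
          (λ a≈b′ → a≉b (≈-trans a≈b′ (≈-sym p))) ,
          Annihilates-resp {a} {a} {b} {b′} ≈-refl p ab≈0)
      , (λ {b} {a} {a′} p (a≉b , ab≈0) →
          (λ a′≈b → a≉b (≈-trans p a′≈b)) ,
          Annihilates-resp {a} {a′} {b} {b} p ≈-refl ab≈0)
    }

  open Digraph Γ using (_⟶_)

  Nᵣ Nₗ : Z* → Pred Z* ℓ
  Nᵣ a b = Annihilates a b
  Nₗ a b = Annihilates b a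

  record Twin (a b : Z*) : Set (c ⊔ ℓ) where
    constructor twin
    field
      Nᵣ≐ : Nᵣ a ≐ Nᵣ b
      Nₗ≐ : Nₗ a ≐ Nₗ b

  Twin-isEquivalence : IsEquivalence Twin
  Twin-isEquivalence = record
    { refl  = twin ≐-refl ≐-refl
    ; sym   = λ (twin p q) → twin (≐-sym p) (≐-sym q)
    ; trans = λ (twin p q) (twin p′ q′) → twin (≐-trans p p′) (≐-trans q q′)
    }

  private module Tw = IsEquivalence Twin-isEquivalence

  ≈ᵥ⇒Twin : ∀ {a b} → a ≈ᵥ b → Twin a b
  ≈ᵥ⇒Twin {a} {b} p = twin
      ( (λ {x} → Annihilates-resp {a} {b} {x} {x} p ≈-refl)
      , (λ {x} → Annihilates-resp {b} {a} {x} {x} (≈-sym p) ≈-refl))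
      ( (λ {x} → Annihilates-resp {x} {x} {a} {b} ≈-refl p)
      , (λ {x} → Annihilates-resp {x} {x} {b} {a} ≈-refl (≈-sym p)))

  Regular : Pred (Automorphism Γ) (c ⊔ ℓ)
  Regular φ = ∀ a → Twin a (Automorphism.to φ a)

  Reg : Group (c ⊔ ℓ) (c ⊔ ℓ)
  Reg = record
    { Carrier = ∃ Regular
    ; _≈_     = λ (φ , _) (ψ , _) → φ A.≈ ψ
    ; _∙_     = λ (φ , φ-reg) (ψ , ψ-reg) →
        φ A.∙ ψ , λ a → Tw.trans (ψ-reg a) (φ-reg (Automorphism.to ψ a))
    ; ε       = A.ε , λ _ → Tw.refl
    ; _⁻¹     = λ (φ , φ-reg) → φ A.⁻¹ , λ a →
        let open Automorphism φ in
        Tw.sym (Tw.trans (φ-reg (from a))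
          (≈ᵥ⇒Twin {to (from a)} {a} (strictlyInverseˡ a)))
    ; isGroup = record
      { isMonoid = record
        { isSemigroup = record
          { isMagma = record
            { isEquivalence = On.isEquivalence proj₁ A.isEquivalence
            ; ∙-cong = λ {(φ , _)} {(φ′ , _)} {(ψ , _)} {(ψ′ , _)} →
                A.∙-cong {φ} {φ′} {ψ} {ψ′}
            }
          ; assoc = λ (φ , _) (ψ , _) (χ , _) → A.assoc φ ψ χ
          }
        ; identity = (λ (φ , _) → A.identityˡ φ) , (λ (φ , _) → A.identityʳ φ)
        }
      ; inverse = (λ (φ , _) → A.inverseˡ φ) , (λ (φ , _) → A.inverseʳ φ)
      ; ⁻¹-cong = λ {(φ , _)} {(ψ , _)} → A.⁻¹-cong {φ} {ψ}
      }
    }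
    where module A = Group (Aut Γ)

  -- The class of a is represented by a itself, with Twin as equality.
  Γ-E : Digraph (c ⊔ ℓ) (c ⊔ ℓ) (c ⊔ ℓ)
  Γ-E = record
    { vertices = record { isEquivalence = Twin-isEquivalence }
    ; _⟶_      = λ a b → ¬ Twin a b × a ⟶ b
    ; ⟶-resp   =
        (λ {a} {b} {b′} b~b′@(twin _ Nₗb≐Nₗb′) (a≁b , _ , ab≈0) →
          let a≁b′ = λ a~b′ → a≁b (Tw.trans a~b′ (Tw.sym b~b′)) in
          a≁b′ , (λ a≈b′ → a≁b′ (≈ᵥ⇒Twin {a} {b′} a≈b′)) , proj₁ Nₗb≐Nₗb′ {a} ab≈0)
      , (λ {b} {a} {a′} a~a′@(twin Nᵣa≐Nᵣa′ _) (a≁b , _ , ab≈0) →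
          let a′≁b = λ a′~b → a≁b (Tw.trans a~a′ a′~b) in
          a′≁b , (λ a′≈b → a′≁b (≈ᵥ⇒Twin {a′} {b} a′≈b)) , proj₁ Nᵣa≐Nᵣa′ {b} ab≈0)
    }

------------------------------------------------------------------------
-- Semidirect products and isomorphisms of groups.

-- Actions of H on N by group automorphisms, i.e. homomorphisms
-- H → Aut(N).
record GroupAction (H : Group c₁ ℓ₁) (N : Group c₂ ℓ₂) :
                   Set (c₁ ⊔ ℓ₁ ⊔ c₂ ⊔ ℓ₂) where
  private
    module H = Group H
    module N = Group N
  infixr 8 _▷_
  field
    _▷_     : H.Carrier → N.Carrier → N.Carrier
    ▷-cong  : ∀ {h h′ n n′} → h H.≈ h′ → n N.≈ n′ → h ▷ n N.≈ h′ ▷ n′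
    ▷-homo  : ∀ h n n′ → h ▷ (n N.∙ n′) N.≈ (h ▷ n) N.∙ (h ▷ n′)
    ε-▷     : ∀ n → H.ε ▷ n N.≈ n
    ∙-▷     : ∀ h h′ n → (h H.∙ h′) ▷ n N.≈ h ▷ h′ ▷ n

-- N × H with (n , h) ∙ (n′ , h′) = (n ∙ (h ▷ n′) , h ∙ h′).
semidirectProduct : (N : Group c₂ ℓ₂) (H : Group c₁ ℓ₁) → GroupAction H N →
                    Group (c₁ ⊔ c₂) (ℓ₁ ⊔ ℓ₂)
semidirectProduct N H θ = record
  { Carrier = N.Carrier × H.Carrier
  ; _≈_     = Pointwise N._≈_ H._≈_
  ; _∙_     = λ (n , h) (n′ , h′) → n N.∙ (h ▷ n′) , h H.∙ h′
  ; ε       = N.ε , H.ε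
  ; _⁻¹     = λ (n , h) → (h H.⁻¹) ▷ (n N.⁻¹) , h H.⁻¹
  ; isGroup = record
    { isMonoid = record
      { isSemigroup = record
        { isMagma = record
          { isEquivalence = ×-isEquivalence N.isEquivalence H.isEquivalence
          ; ∙-cong = λ (p , q) (p′ , q′) → N.∙-cong p (▷-cong q p′) , H.∙-cong q q′
          }
        ; assoc = λ (n , h) (n′ , h′) (n″ , h″) →
            N.trans (N.assoc n (h ▷ n′) ((h H.∙ h′) ▷ n″))
              (N.∙-congˡ (N.trans (N.∙-congˡ (∙-▷ h h′ n″))
                                  (N.sym (▷-homo h n′ (h′ ▷ n″)))))
          , H.assoc h h′ h″
        }
      ; identity =
          (λ (n , h) → N.trans (N.identityˡ _) (ε-▷ n) , H.identityˡ h)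
        , (λ (n , h) → N.trans (N.∙-congˡ (▷-ε h)) (N.identityʳ n) , H.identityʳ h)
      }
    ; inverse =
        (λ (n , h) →
            N.trans (N.sym (▷-homo (h H.⁻¹) (n N.⁻¹) n))
              (N.trans (▷-cong H.refl (N.inverseˡ n)) (▷-ε (h H.⁻¹)))
          , H.inverseˡ h)
      , (λ (n , h) →
            N.trans (N.∙-congˡ (N.trans (N.sym (∙-▷ h (h H.⁻¹) (n N.⁻¹)))
              (N.trans (▷-cong (H.inverseʳ h) N.refl) (ε-▷ (n N.⁻¹)))))
              (N.inverseʳ n)
          , H.inverseʳ h)
    ; ⁻¹-cong = λ (p , q) → ▷-cong (H.⁻¹-cong q) (N.⁻¹-cong p) , H.⁻¹-cong q
    }
  }
  where
  module N = Group N
  module H = Group H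
  open GroupAction θ
  ▷-ε : ∀ h → h ▷ N.ε N.≈ N.ε
  ▷-ε h = identityˡ-unique (h ▷ N.ε) (h ▷ N.ε)
    (N.trans (N.sym (▷-homo h N.ε N.ε)) (▷-cong H.refl (N.identityˡ N.ε)))
    where open GroupProperties N using (identityˡ-unique)

syntax semidirectProduct N H θ = N ⋊[ θ ] H

infix 4 _≅_

_≅_ : Group c₁ ℓ₁ → Group c₂ ℓ₂ → Set (c₁ ⊔ ℓ₁ ⊔ c₂ ⊔ ℓ₂)
G ≅ H = ∃ (IsGroupIsomorphism (Group.rawGroup G) (Group.rawGroup H))

{-# OPTIONS --safe #-}
module Submission where

-- Write M for the integral quaternions with even coordinate sum, and I for those
-- whose coordinates all have the same parity.  The chain M ⊃ I ⊃ 2M ⊃ 2I ⊃ …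
-- consists of the traces on ℤ⁴ of the powers of the maximal ideal of the 2-adic
-- Hurwitz order; its quotients have four elements, and modulo 2ˢ the zero divisors
-- are M.  Hence a vertex of Γ has a level m and, as its leading term, one of three
-- colours; xy = 0 depends only on levels and colours, and (except at the last level,
-- which is a single vertex) the twin classes are the classes of given level and
-- colour.
--
-- Adding the last vertex to any other vertex gives a twin of it, so automorphisms of
-- Γ preserve twins and induce automorphisms of Γ-E.  Conversely, the vicinal preorder
-- of Γ-E shows that its automorphisms σ preserve levels and the condition x² = 0.
-- With c(x) a leading term chosen for each class, x ↦ x - c(x) + c(σ x) then lifts σ
-- to Γ, compatibly with composition.  This splits the extension
-- 1 → Reg → Aut Γ → Aut Γ-E → 1.

open import Algebra.Bundles using (Group; Ring)
open import Algebra.Morphism.Structures using (IsGroupHomomorphism; IsGroupMonomorphism)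
import Algebra.Properties.Group as GroupProperties
open import Data.Fin using (#_)
open import Data.Fin.Base using (Fin)
open import Data.Fin.Patterns using (0F; 1F; 2F)
open import Data.Fin.Properties using (all?; any?; _≟_)
open import Data.Integer.Base using (ℤ; +_; 0ℤ; 1ℤ; -1ℤ)
  renaming (_+_ to infixl 6 _+ᶻ_; _-_ to infixl 6 _-ᶻ_; _*_ to infixl 7 _*ᶻ_; -_ to infix 8 -ᶻ_)
open import Data.Integer.DivMod using (_%ℕ_; _/ℕ_; a≡a%ℕn+[a/ℕn]*n; n%ℕd<d)
open import Data.Integer.Divisibility.Signed using (divides; _∣?_)
import Data.Integer.Properties as ℤₚ
import Data.Integer.Tactic.RingSolver as ℤ-Solver
open import Data.Nat.Base
  using (ℕ; zero; suc; _+_; _∸_; _^_; _≤_; _<_; z≤n; s≤s; s≤s⁻¹; _≤′_; ≤′-refl; ≤′-step)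
import Data.Nat.Properties as ℕₚ
open import Data.Product.Base using (Σ-syntax; ∃; ∃₂; _×_; _,_; proj₁; proj₂)
open import Data.Sum.Base as Sum using (_⊎_; inj₁; inj₂)
open import Data.Vec.Base using (Vec; []; _∷_; _++_)
open import Defs
open import Function.Base using (_∘_; flip)
open import Level using (Level; 0ℓ; _⊔_) renaming (suc to lsuc)
open import Relation.Binary.Core using (Rel)
open import Relation.Binary.Definitions using (Decidable; tri<; tri≈; tri>)
open import Relation.Binary.PropositionalEquality
  using (_≡_; _≢_; refl; sym; trans; cong; subst; module ≡-Reasoning)
import Relation.Binary.Reasoning.Setoid as SetoidReasoning
open import Relation.Binary.Structures using (IsEquivalence)
open import Relation.Nullary.Decidable
  using (Dec; yes; no; from-yes; from-no; ¬?; map′; _→-dec_; _×-dec_; _⊎-dec_)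
open import Relation.Nullary.Negation using (¬_; contradiction)
open import Tactic.RingSolver.NonReflective ℤ-Solver.ring
  using (Expr; Κ; Ι; module Ops)
  renaming (_⊕_ to infixl 6 _:+_; _⊗_ to infixl 7 _:*_; ⊝_ to infix 8 :-_)

private
  variable
    a₁ a₂ a₃ r₁ r₂ r₃ c ℓ p q : Level

-- Split extensions of groups

record SplitExtension (N : Group a₁ r₁) (G : Group a₂ r₂) (H : Group a₃ r₃) :
                      Set (a₁ ⊔ r₁ ⊔ a₂ ⊔ r₂ ⊔ a₃ ⊔ r₃) where
  private
    module N = Group N
    module G = Group G
    module H = Group H

  field
    ι : N.Carrier → G.Carrier
    π : G.Carrier → H.Carrier
    σ : H.Carrier → G.Carrier
    ι-mono : IsGroupMonomorphism N.rawGroup G.rawGroup ι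
    π-hom  : IsGroupHomomorphism G.rawGroup H.rawGroup π
    σ-hom  : IsGroupHomomorphism H.rawGroup G.rawGroup σ
    π∘σ≈id : ∀ h → π (σ h) H.≈ h
    π∘ι≈ε  : ∀ n → π (ι n) H.≈ H.ε
    kernel : ∀ g → π g H.≈ H.ε → ∃ λ n → ι n G.≈ g

  private
    module ι = IsGroupMonomorphism ι-mono
    module π = IsGroupHomomorphism π-hom
    module σ = IsGroupHomomorphism σ-hom
    open G using (_∙_; _⁻¹; ε)
    open GroupProperties G using (⁻¹-anti-homo-∙; //-rightDividesˡ; //-rightDividesʳ)

    module G-Reasoning = SetoidReasoning G.setoid
    module H-Reasoning = SetoidReasoning H.setoid

  private
    conjugate∈kernel : ∀ h n → π (σ h ∙ ι n ∙ σ h ⁻¹) H.≈ H.ε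
    conjugate∈kernel h n = begin
      π (σ h ∙ ι n ∙ σ h ⁻¹)               ≈⟨ π.homo _ _ ⟩
      π (σ h ∙ ι n) H.∙ π (σ h ⁻¹)         ≈⟨ H.∙-cong (π.homo _ _) (π.⁻¹-homo _) ⟩
      π (σ h) H.∙ π (ι n) H.∙ π (σ h) H.⁻¹ ≈⟨ H.∙-congʳ (H.∙-congˡ (π∘ι≈ε n)) ⟩
      π (σ h) H.∙ H.ε H.∙ π (σ h) H.⁻¹     ≈⟨ H.∙-congʳ (H.identityʳ _) ⟩
      π (σ h) H.∙ π (σ h) H.⁻¹             ≈⟨ H.inverseʳ _ ⟩
      H.ε                                  ∎
      where open H-Reasoning

    remainder∈kernel : ∀ g → π (g ∙ σ (π g) ⁻¹) H.≈ H.ε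
    remainder∈kernel g = begin
      π (g ∙ σ (π g) ⁻¹)           ≈⟨ π.homo _ _ ⟩
      π g H.∙ π (σ (π g) ⁻¹)       ≈⟨ H.∙-congˡ (π.⁻¹-homo _) ⟩
      π g H.∙ π (σ (π g)) H.⁻¹     ≈⟨ H.∙-congˡ (H.⁻¹-cong (π∘σ≈id (π g))) ⟩
      π g H.∙ π g H.⁻¹             ≈⟨ H.inverseʳ _ ⟩
      H.ε                          ∎
      where open H-Reasoning

    infixr 8 _▷_
    -- Exactness only yields some preimage of the conjugate. The laws of the action are therefore
    -- checked after applying `ι`, which is injective.
    _▷_ : H.Carrier → N.Carrier → N.Carrier
    h ▷ n = proj₁ (kernel _ (conjugate∈kernel h n))

    ι-▷ : ∀ h n → ι (h ▷ n) G.≈ σ h ∙ ι n ∙ σ h ⁻¹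
    ι-▷ h n = proj₂ (kernel _ (conjugate∈kernel h n))

    conj-homo : ∀ x y z → x ∙ (y ∙ z) ∙ x ⁻¹ G.≈ (x ∙ y ∙ x ⁻¹) ∙ (x ∙ z ∙ x ⁻¹)
    conj-homo x y z = begin
      x ∙ (y ∙ z) ∙ x ⁻¹                  ≈⟨ G.∙-congʳ (G.assoc x y z) ⟨
      x ∙ y ∙ z ∙ x ⁻¹                    ≈⟨ G.∙-congʳ (G.∙-congʳ (//-rightDividesˡ x (x ∙ y))) ⟨
      x ∙ y ∙ x ⁻¹ ∙ x ∙ z ∙ x ⁻¹         ≈⟨ G.∙-congʳ (G.assoc _ x z) ⟩
      x ∙ y ∙ x ⁻¹ ∙ (x ∙ z) ∙ x ⁻¹       ≈⟨ G.assoc _ (x ∙ z) (x ⁻¹) ⟩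
      (x ∙ y ∙ x ⁻¹) ∙ (x ∙ z ∙ x ⁻¹)     ∎
      where open G-Reasoning

    conj-∙ : ∀ x y z → (x ∙ y) ∙ z ∙ (x ∙ y) ⁻¹ G.≈ x ∙ (y ∙ z ∙ y ⁻¹) ∙ x ⁻¹
    conj-∙ x y z = begin
      x ∙ y ∙ z ∙ (x ∙ y) ⁻¹        ≈⟨ G.∙-cong (G.assoc x y z) (⁻¹-anti-homo-∙ x y) ⟩
      x ∙ (y ∙ z) ∙ (y ⁻¹ ∙ x ⁻¹)   ≈⟨ G.assoc _ (y ⁻¹) (x ⁻¹) ⟨
      x ∙ (y ∙ z) ∙ y ⁻¹ ∙ x ⁻¹     ≈⟨ G.∙-congʳ (G.assoc x (y ∙ z) (y ⁻¹)) ⟩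
      x ∙ (y ∙ z ∙ y ⁻¹) ∙ x ⁻¹     ∎
      where open G-Reasoning

  conjugation : GroupAction H N
  conjugation = record
    { _▷_    = _▷_
    ; ▷-cong = λ {h} {h′} {n} {n′} p q → ι.injective (begin
        ι (h ▷ n)             ≈⟨ ι-▷ h n ⟩
        σ h ∙ ι n ∙ σ h ⁻¹    ≈⟨ G.∙-cong (G.∙-cong (σ.⟦⟧-cong p) (ι.⟦⟧-cong q)) (G.⁻¹-cong (σ.⟦⟧-cong p)) ⟩
        σ h′ ∙ ι n′ ∙ σ h′ ⁻¹ ≈⟨ ι-▷ h′ n′ ⟨
        ι (h′ ▷ n′)           ∎)
    ; ▷-homo = λ h n n′ → ι.injective (begin
        ι (h ▷ (n N.∙ n′))                          ≈⟨ ι-▷ h _ ⟩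
        σ h ∙ ι (n N.∙ n′) ∙ σ h ⁻¹                 ≈⟨ G.∙-congʳ (G.∙-congˡ (ι.∙-homo n n′)) ⟩
        σ h ∙ (ι n ∙ ι n′) ∙ σ h ⁻¹                 ≈⟨ conj-homo _ _ _ ⟩
        (σ h ∙ ι n ∙ σ h ⁻¹) ∙ (σ h ∙ ι n′ ∙ σ h ⁻¹) ≈⟨ G.∙-cong (ι-▷ h n) (ι-▷ h n′) ⟨
        ι (h ▷ n) ∙ ι (h ▷ n′)                      ≈⟨ ι.∙-homo _ _ ⟨
        ι ((h ▷ n) N.∙ (h ▷ n′))                    ∎)
    ; ε-▷    = λ n → ι.injective (begin
        ι (H.ε ▷ n)              ≈⟨ ι-▷ H.ε n ⟩
        σ H.ε ∙ ι n ∙ σ H.ε ⁻¹   ≈⟨ G.∙-cong (G.∙-congʳ σ.ε-homo) (G.⁻¹-cong σ.ε-homo) ⟩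
        ε ∙ ι n ∙ ε ⁻¹           ≈⟨ G.∙-congʳ (G.trans (G.identityˡ _) (G.sym (G.identityʳ _))) ⟩
        ι n ∙ ε ∙ ε ⁻¹           ≈⟨ //-rightDividesʳ ε (ι n) ⟩
        ι n                      ∎)
    ; ∙-▷    = λ h h′ n → ι.injective (begin
        ι ((h H.∙ h′) ▷ n)                          ≈⟨ ι-▷ _ n ⟩
        σ (h H.∙ h′) ∙ ι n ∙ σ (h H.∙ h′) ⁻¹         ≈⟨ G.∙-cong (G.∙-congʳ (σ.homo h h′))
                                                           (G.⁻¹-cong (σ.homo h h′)) ⟩
        (σ h ∙ σ h′) ∙ ι n ∙ (σ h ∙ σ h′) ⁻¹         ≈⟨ conj-∙ _ _ _ ⟩
        σ h ∙ (σ h′ ∙ ι n ∙ σ h′ ⁻¹) ∙ σ h ⁻¹        ≈⟨ G.∙-congʳ (G.∙-congˡ (ι-▷ h′ n)) ⟨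
        σ h ∙ ι (h′ ▷ n) ∙ σ h ⁻¹                    ≈⟨ ι-▷ h _ ⟨
        ι (h ▷ h′ ▷ n)                               ∎)
    }
    where open G-Reasoning

  private
    N⋊H = N ⋊[ conjugation ] H
    module N⋊H = Group N⋊H

    remainder : G.Carrier → N.Carrier
    remainder g = proj₁ (kernel _ (remainder∈kernel g))

    ι-remainder : ∀ g → ι (remainder g) G.≈ g ∙ σ (π g) ⁻¹
    ι-remainder g = proj₂ (kernel _ (remainder∈kernel g))

    ι-remainder-∙ : ∀ g → ι (remainder g) ∙ σ (π g) G.≈ g
    ι-remainder-∙ g = G.trans (G.∙-congʳ (ι-remainder g)) (//-rightDividesˡ _ g)

    decompose : G.Carrier → N⋊H.Carrier
    decompose g = remainder g , π g

    compose : N⋊H.Carrier → G.Carrier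
    compose (n , h) = ι n ∙ σ h

    compose-homo : ∀ x y → compose (x N⋊H.∙ y) G.≈ compose x ∙ compose y
    compose-homo (n , h) (n′ , h′) = begin
      ι (n N.∙ (h ▷ n′)) ∙ σ (h H.∙ h′)              ≈⟨ G.∙-cong (ι.∙-homo _ _) (σ.homo h h′) ⟩
      ι n ∙ ι (h ▷ n′) ∙ (σ h ∙ σ h′)                ≈⟨ G.∙-congʳ (G.∙-congˡ (ι-▷ h n′)) ⟩
      ι n ∙ (σ h ∙ ι n′ ∙ σ h ⁻¹) ∙ (σ h ∙ σ h′)     ≈⟨ G.assoc _ (σ h) (σ h′) ⟨
      ι n ∙ (σ h ∙ ι n′ ∙ σ h ⁻¹) ∙ σ h ∙ σ h′       ≈⟨ G.∙-congʳ (G.assoc (ι n) _ (σ h)) ⟩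
      ι n ∙ (σ h ∙ ι n′ ∙ σ h ⁻¹ ∙ σ h) ∙ σ h′       ≈⟨ G.∙-congʳ (G.∙-congˡ (//-rightDividesˡ (σ h) _)) ⟩
      ι n ∙ (σ h ∙ ι n′) ∙ σ h′                      ≈⟨ G.∙-congʳ (G.assoc (ι n) (σ h) (ι n′)) ⟨
      ι n ∙ σ h ∙ ι n′ ∙ σ h′                        ≈⟨ G.assoc _ (ι n′) (σ h′) ⟩
      (ι n ∙ σ h) ∙ (ι n′ ∙ σ h′)                    ∎
      where open G-Reasoning

    π-compose : ∀ x → π (compose x) H.≈ proj₂ x
    π-compose (n , h) = begin
      π (ι n ∙ σ h)          ≈⟨ π.homo _ _ ⟩
      π (ι n) H.∙ π (σ h)    ≈⟨ H.∙-cong (π∘ι≈ε n) (π∘σ≈id h) ⟩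
      H.ε H.∙ h              ≈⟨ H.identityˡ h ⟩
      h                      ∎
      where open H-Reasoning

    -- Applying `π` recovers h, and cancelling `σ h` then recovers n. As `compose` undoes
    -- `decompose`, this reduces the laws of `decompose` to those of `compose`.
    compose-injective : ∀ {x y} → compose x G.≈ compose y → x N⋊H.≈ y
    compose-injective {x@(n , h)} {y@(n′ , h′)} p = ι.injective n≈n′ , h≈h′
      where
      h≈h′ = H.trans (H.sym (π-compose x)) (H.trans (π.⟦⟧-cong p) (π-compose y))
      open G-Reasoning
      n≈n′ : ι n G.≈ ι n′
      n≈n′ = begin
        ι n                    ≈⟨ //-rightDividesʳ (σ h) (ι n) ⟨
        ι n ∙ σ h ∙ σ h ⁻¹     ≈⟨ G.∙-cong p (G.⁻¹-cong (σ.⟦⟧-cong h≈h′)) ⟩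
        ι n′ ∙ σ h′ ∙ σ h′ ⁻¹  ≈⟨ //-rightDividesʳ (σ h′) (ι n′) ⟩
        ι n′                   ∎

    decompose-cong : ∀ {g g′} → g G.≈ g′ → decompose g N⋊H.≈ decompose g′
    decompose-cong {g} {g′} p = compose-injective
      (G.trans (ι-remainder-∙ g) (G.trans p (G.sym (ι-remainder-∙ g′))))

    decompose-homo : ∀ g g′ → decompose (g ∙ g′) N⋊H.≈ decompose g N⋊H.∙ decompose g′
    decompose-homo g g′ = compose-injective (begin
      compose (decompose (g ∙ g′))             ≈⟨ ι-remainder-∙ (g ∙ g′) ⟩
      g ∙ g′                                   ≈⟨ G.∙-cong (ι-remainder-∙ g) (ι-remainder-∙ g′) ⟨
      compose (decompose g) ∙ compose (decompose g′) ≈⟨ compose-homo (decompose g) (decompose g′) ⟨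
      compose (decompose g N⋊H.∙ decompose g′) ∎)
      where open G-Reasoning

  splits : G ≅ N⋊H
  splits = decompose , record
    { isGroupMonomorphism = record
      { isGroupHomomorphism = record
        { isMonoidHomomorphism = record
          { isMagmaHomomorphism = record
            { isRelHomomorphism = record { cong = decompose-cong }
            ; homo              = decompose-homo
            }
          ; ε-homo = identityˡ-unique (decompose ε) (decompose ε)
              (N⋊H.trans (N⋊H.sym (decompose-homo ε ε)) (decompose-cong (G.identityˡ ε)))
          }
        ; ⁻¹-homo = λ g → inverseˡ-unique (decompose (g ⁻¹)) (decompose g)
            (N⋊H.trans (N⋊H.sym (decompose-homo (g ⁻¹) g))
              (N⋊H.trans (decompose-cong (G.inverseˡ g)) decompose-ε))
        }
      ; injective = λ {g} {g′} (p , q) →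
          G.trans (G.sym (ι-remainder-∙ g))
            (G.trans (G.∙-cong (ι.⟦⟧-cong p) (σ.⟦⟧-cong q)) (ι-remainder-∙ g′))
      }
    ; surjective = λ y → compose y , λ p →
        compose-injective (G.trans (ι-remainder-∙ _) p)
    }
    where
    open GroupProperties N⋊H using (identityˡ-unique; inverseˡ-unique)
    decompose-ε : decompose ε N⋊H.≈ N⋊H.ε
    decompose-ε = identityˡ-unique (decompose ε) (decompose ε)
      (N⋊H.trans (N⋊H.sym (decompose-homo ε ε)) (decompose-cong (G.identityˡ ε)))

SplitExtension⇒⋊ : {N : Group a₁ r₁} {G : Group a₂ r₂} {H : Group a₃ r₃} → SplitExtension N G H →
                   Σ[ θ ∈ GroupAction H N ] G ≅ (N ⋊[ θ ] H)
SplitExtension⇒⋊ E = conjugation , splits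
  where open SplitExtension E

-- From automorphisms of Γ to automorphisms of Γ-E

-- Edges of Γ join distinct vertices only, so they never show whether a² = 0. A second member of its
-- twin class can stand in for a vertex in this respect.
HasOtherTwinOrIsTop : (R : Ring c ℓ) → ZeroDivisorGraph.Z* R → Set (c ⊔ ℓ)
HasOtherTwinOrIsTop R a =
  (∃ λ a′ → ¬ proj₁ a R.≈ proj₁ a′ × Twin a a′) ⊎ (∀ x → Annihilates a x × Annihilates x a)
  where
  module R = Ring R
  open ZeroDivisorGraph R

module InducedAutomorphism {c ℓ : Level} (R : Ring c ℓ) (_≟_ : Decidable (Ring._≈_ R))
                           (twinned : ∀ a → HasOtherTwinOrIsTop R a) where

  open Ring R using (_≈_) renaming (sym to ≈-sym; trans to ≈-trans; refl to ≈-refl)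
  open ZeroDivisorGraph R
  open Automorphism
  private
    module Tw = IsEquivalence Twin-isEquivalence

  private
    module Half
      (_⊥_ : Rel Z* ℓ)
      (⊥-respˡ : ∀ {a a′ x} → Twin a a′ → a ⊥ x → a′ ⊥ x)
      (⊥-respʳ : ∀ {a a′ x} → Twin a a′ → x ⊥ a → x ⊥ a′)
      (⊥-top : ∀ {a} → (∀ x → Annihilates a x × Annihilates x a) → ∀ x → x ⊥ a)
      where

      -- The two exceptional values of x are replaced by twins of theirs.
      open-⊆⇒⊆ : ∀ {a b} → (∀ x → ¬ proj₁ x ≈ proj₁ a → ¬ proj₁ x ≈ proj₁ b → a ⊥ x → b ⊥ x) →
                 ∀ x → a ⊥ x → b ⊥ x
      open-⊆⇒⊆ {a} {b} a⊆b x a⊥x with proj₁ x ≟ proj₁ a | proj₁ x ≟ proj₁ b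
      ... | no x≉a  | no x≉b = a⊆b x x≉a x≉b a⊥x
      ... | yes x≈a | _ with twinned x
      ...   | inj₂ top = ⊥-top top b
      ...   | inj₁ (x′ , x≉x′ , x~x′) with proj₁ x′ ≟ proj₁ b
      -- The replacement is itself exceptional only if a and b are twins, and then the claim is
      -- immediate.
      ...     | yes x′≈b = ⊥-respˡ (Tw.trans (Tw.sym (≈ᵥ⇒Twin {x} {a} x≈a))
                                       (Tw.trans x~x′ (≈ᵥ⇒Twin {x′} {b} x′≈b))) a⊥x
      ...     | no x′≉b = ⊥-respʳ (Tw.sym x~x′)
                  (a⊆b x′ (λ x′≈a → x≉x′ (≈-trans x≈a (≈-sym x′≈a))) x′≉b (⊥-respʳ x~x′ a⊥x))
      open-⊆⇒⊆ {a} {b} a⊆b x a⊥x | no x≉a | yes x≈b with twinned x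
      ...   | inj₂ top = ⊥-top top b
      ...   | inj₁ (x′ , x≉x′ , x~x′) with proj₁ x′ ≟ proj₁ a
      ...     | yes x′≈a = ⊥-respˡ (Tw.trans (Tw.sym (≈ᵥ⇒Twin {x′} {a} x′≈a))
                                       (Tw.trans (Tw.sym x~x′) (≈ᵥ⇒Twin {x} {b} x≈b))) a⊥x
      ...     | no x′≉a = ⊥-respʳ (Tw.sym x~x′)
                  (a⊆b x′ x′≉a (λ x′≈b → x≉x′ (≈-trans x≈b (≈-sym x′≈b))) (⊥-respʳ x~x′ a⊥x))

    annihilates-respˡ : ∀ {a a′ x} → Twin a a′ → Annihilates a x → Annihilates a′ x
    annihilates-respˡ {x = x} (twin p _) = proj₁ p {x}

    annihilates-respʳ : ∀ {a a′ x} → Twin a a′ → Annihilates x a → Annihilates x a′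
    annihilates-respʳ {x = x} (twin _ q) = proj₁ q {x}

    module Right = Half Annihilates
      (λ {a} {a′} {x} → annihilates-respˡ {a} {a′} {x})
      (λ {a} {a′} {x} → annihilates-respʳ {a} {a′} {x})
      (λ top x → proj₂ (top x))
    module Left = Half (flip Annihilates)
      (λ {a} {a′} {x} → annihilates-respʳ {a} {a′} {x})
      (λ {a} {a′} {x} → annihilates-respˡ {a} {a′} {x})
      (λ top x → proj₁ (top x))

  -- A vertex other than φ a and φ b pulls back to one other than a and b, where annihilation is
  -- adjacency and passes through φ. The excluded vertices are dealt with by `open-⊆⇒⊆`.
  to-Twin : ∀ (φ : Automorphism Γ) {a b} → Twin a b → Twin (to φ a) (to φ b)
  to-Twin φ {a} {b} a~b = twin
    ( (λ {x} → Right.open-⊆⇒⊆ {to φ a} {to φ b} (right a~b) x)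
    , (λ {x} → Right.open-⊆⇒⊆ {to φ b} {to φ a} (right (Tw.sym a~b)) x))
    ( (λ {x} → Left.open-⊆⇒⊆ {to φ a} {to φ b} (left a~b) x)
    , (λ {x} → Left.open-⊆⇒⊆ {to φ b} {to φ a} (left (Tw.sym a~b)) x))
    where
    φφ⁻¹ : ∀ x → proj₁ (to φ (from φ x)) ≈ proj₁ x
    φφ⁻¹ = strictlyInverseˡ φ

    from≉ : ∀ {x a} → ¬ proj₁ x ≈ proj₁ (to φ a) → ¬ proj₁ (from φ x) ≈ proj₁ a
    from≉ {x} {a} x≉φa p = x≉φa (≈-trans (≈-sym (φφ⁻¹ x)) (to-cong φ {from φ x} {a} p))

    right : ∀ {a b} → Twin a b → ∀ x → ¬ proj₁ x ≈ proj₁ (to φ a) → ¬ proj₁ x ≈ proj₁ (to φ b) →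
            Annihilates (to φ a) x → Annihilates (to φ b) x
    right {a} {b} (twin p _) x x≉φa x≉φb φax≈0 =
      let x′ = from φ x
          _ , ax′≈0 = reflects φ {a} {x′}
            ( (λ e → x≉φa (≈-sym (≈-trans e (φφ⁻¹ x))))
            , Annihilates-resp {to φ a} {to φ a} {x} {to φ x′} ≈-refl (≈-sym (φφ⁻¹ x)) φax≈0)
          _ , φbx≈0 = preserves φ {b} {x′} (from≉ {x} {b} x≉φb ∘ ≈-sym , proj₁ p {x′} ax′≈0)
      in Annihilates-resp {to φ b} {to φ b} {to φ x′} {x} ≈-refl (φφ⁻¹ x) φbx≈0

    left : ∀ {a b} → Twin a b → ∀ x → ¬ proj₁ x ≈ proj₁ (to φ a) → ¬ proj₁ x ≈ proj₁ (to φ b) →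
           Annihilates x (to φ a) → Annihilates x (to φ b)
    left {a} {b} (twin _ q) x x≉φa x≉φb xφa≈0 =
      let x′ = from φ x
          _ , x′a≈0 = reflects φ {x′} {a}
            ( (λ e → x≉φa (≈-trans (≈-sym (φφ⁻¹ x)) e))
            , Annihilates-resp {x} {to φ x′} {to φ a} {to φ a} (≈-sym (φφ⁻¹ x)) ≈-refl xφa≈0)
          _ , xφb≈0 = preserves φ {x′} {b} (from≉ {x} {b} x≉φb , proj₁ q {x′} x′a≈0)
      in Annihilates-resp {to φ x′} {x} {to φ b} {to φ b} (φφ⁻¹ x) ≈-refl xφb≈0

  private
    module Aut-Γ = Group (Aut Γ)

  from-Twin : ∀ (φ : Automorphism Γ) {a b} → Twin a b → Twin (from φ a) (from φ b)
  from-Twin φ = to-Twin (φ Aut-Γ.⁻¹)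

  induced : Automorphism Γ → Automorphism Γ-E
  induced φ = record
    { bijection = record
      { to        = to φ
      ; from      = from φ
      ; to-cong   = to-Twin φ
      ; from-cong = from-Twin φ
      ; inverse   =
          (λ {a} p → Tw.trans (to-Twin φ p) (to∘from~id a))
        , (λ {a} p → Tw.trans (from-Twin φ p) (from∘to~id a))
      }
    ; preserves = λ {a} {b} (a≁b , a→b) → a≁b ∘ to-Twin⁻¹ , preserves φ {a} {b} a→b
    ; reflects  = λ {a} {b} (φa≁φb , φa→φb) → φa≁φb ∘ to-Twin φ , reflects φ {a} {b} φa→φb
    }
    where
    to∘from~id : ∀ a → Twin (to φ (from φ a)) a
    to∘from~id a = ≈ᵥ⇒Twin {to φ (from φ a)} {a} (strictlyInverseˡ φ a)
    from∘to~id : ∀ a → Twin (from φ (to φ a)) a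
    from∘to~id a = ≈ᵥ⇒Twin {from φ (to φ a)} {a} (strictlyInverseʳ φ a)
    to-Twin⁻¹ : ∀ {a b} → Twin (to φ a) (to φ b) → Twin a b
    to-Twin⁻¹ {a} {b} p = Tw.trans (Tw.sym (from∘to~id a)) (Tw.trans (from-Twin φ p) (from∘to~id b))

  induced-isGroupHomomorphism :
    IsGroupHomomorphism (Group.rawGroup (Aut Γ)) (Group.rawGroup (Aut Γ-E)) induced
  induced-isGroupHomomorphism = record
    { isMonoidHomomorphism = record
      { isMagmaHomomorphism = record
        { isRelHomomorphism = record { cong = λ {φ} {ψ} p a → ≈ᵥ⇒Twin {to φ a} {to ψ a} (p a) }
        ; homo = λ _ _ _ → Tw.refl
        }
      ; ε-homo = λ _ → Tw.refl
      }
    ; ⁻¹-homo = λ _ _ → Tw.refl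
    }

-- From automorphisms of Γ-E to automorphisms of Γ

Colour : Set
Colour = Fin 3

-- Lets a vertex of prescribed level avoid two colours at once, which separates twin classes below.
third-colour : ∀ (α β : Colour) → ∃ λ γ → γ ≢ α × γ ≢ β
third-colour = from-yes (all? λ (α : Colour) → all? λ (β : Colour) → any? λ γ → ¬? (γ ≟ α) ×-dec ¬? (γ ≟ β))

-- Levels run from 0 to 1 + T, and the last level is a single twin class for all its colours.
record Levelling (R : Ring c ℓ) (T : ℕ) : Set (c ⊔ ℓ ⊔ lsuc p) where
  open Ring R using (Carrier; _≈_) renaming (_+_ to _⊕_; _-_ to _⊝_)
  open ZeroDivisorGraph R
  field
    dual            : ℕ → Colour → Colour
    dual-involutive : ∀ {m n} α → m + n ≡ T → dual n (dual m α) ≡ α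
    leader          : ℕ → Colour → Carrier
    Typed           : ℕ → Colour → Z* → Set p
    classify        : ∀ x → ∃₂ λ m α → Typed m α x
    Typed⇒≤         : ∀ {m α x} → Typed m α x → m ≤ suc T
    inhabited       : ∀ {m} α → m ≤ T → ∃ (Typed m α)
    annihilates⁻    : ∀ {m α n β x y} → Typed m α x → Typed n β y → Annihilates x y →
                      T < m + n ⊎ m + n ≡ T × β ≡ dual m α
    annihilates⁺    : ∀ {m α n β x y} → Typed m α x → Typed n β y →
                      T < m + n ⊎ m + n ≡ T × β ≡ dual m α → Annihilates x y
    -- The vertex y certifies that colour β occurs at level m; at the last level a leader may be
    -- zero.
    translate       : ∀ {m α β x y} → Typed m α x → Typed m β y →
                      ∃ λ z → Typed m β z × proj₁ z ≈ (proj₁ x ⊝ leader m α) ⊕ leader m β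
    top-unique      : ∀ {α β x y} → Typed (suc T) α x → Typed (suc T) β y →
                      leader (suc T) α ≈ leader (suc T) β

-- Lexicographic ranks: twice a number plus a tie-breaking bit

module _ {P : Set p} where

  non : Dec P → ℕ
  non (yes _) = 0
  non (no _)  = 1

  non≤1 : ∀ P? → non P? ≤ 1
  non≤1 (yes _) = z≤n
  non≤1 (no _)  = s≤s z≤n

module _ {P : Set p} {Q : Set q} (P? : Dec P) (Q? : Dec Q) where

  <⇒2*+non-< : ∀ {m n} → m < n → m + m + non P? < n + n + non Q?
  <⇒2*+non-< {m} {n} m<n = begin-strict
    m + m + non P?       ≤⟨ ℕₚ.+-monoʳ-≤ (m + m) (non≤1 P?) ⟩
    m + m + 1            ≡⟨ ℕₚ.+-comm (m + m) 1 ⟩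
    suc (m + m)          <⟨ ℕₚ.n<1+n _ ⟩
    suc (suc (m + m))    ≡⟨ cong suc (ℕₚ.+-suc m m) ⟨
    suc m + suc m        ≤⟨ ℕₚ.+-mono-≤ m<n m<n ⟩
    n + n                ≤⟨ ℕₚ.m≤m+n (n + n) _ ⟩
    n + n + non Q?       ∎
    where open ℕₚ.≤-Reasoning

module _ {P : Set p} {Q : Set q} (P? : Dec P) (Q? : Dec Q) where

  2*+non-<⇒ : ∀ {m n} → m + m + non P? < n + n + non Q? →
              m < n ⊎ m ≡ n × P × ¬ Q
  2*+non-<⇒ {m} {n} lt with ℕₚ.<-cmp m n
  ... | tri< m<n _ _ = inj₁ m<n
  ... | tri> _ _ n<m = contradiction lt (ℕₚ.<⇒≯ (<⇒2*+non-< Q? P? n<m))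
  ... | tri≈ _ refl _ = inj₂ (refl , bits P? Q? (ℕₚ.+-cancelˡ-< (m + m) _ _ lt))
    where
    bits : (P? : Dec P) (Q? : Dec Q) → non P? < non Q? → P × ¬ Q
    bits (yes p) (no ¬q) _        = p , ¬q
    bits (no _)  (no _)  (s≤s ())
    bits (yes _) (yes _) ()
    bits (no _)  (yes _) ()

  2*+non-≡⇒ : ∀ {m n} → m + m + non P? ≡ n + n + non Q? →
              m ≡ n × (P → Q) × (Q → P)
  2*+non-≡⇒ {m} {n} eq with ℕₚ.<-cmp m n
  ... | tri< m<n _ _ = contradiction eq (ℕₚ.<⇒≢ (<⇒2*+non-< P? Q? m<n))
  ... | tri> _ _ n<m = contradiction (sym eq) (ℕₚ.<⇒≢ (<⇒2*+non-< Q? P? n<m))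
  ... | tri≈ _ refl _ = refl , bits P? Q? (ℕₚ.+-cancelˡ-≡ (m + m) _ _ eq)
    where
    bits : (P? : Dec P) (Q? : Dec Q) → non P? ≡ non Q? → (P → Q) × (Q → P)
    bits (yes p) (yes q) _ = (λ _ → q) , (λ _ → p)
    bits (no ¬p) (no ¬q) _ = (λ p → contradiction p ¬p) , (λ q → contradiction q ¬q)

module _ {A : Set c} (rank : A → ℕ) (bound : ℕ) (rank≤ : ∀ x → rank x ≤ bound)
         (f : A → A) (f-mono : ∀ {x y} → rank x < rank y → rank (f x) < rank (f y)) where

  -- Otherwise the ranks of the iterates of f at x would increase forever.
  rank-≮-image : ∀ x → ¬ rank x < rank (f x)
  rank-≮-image x = ascend bound x (ℕₚ.m≤m+n bound (rank x))
    where
    open ℕₚ.≤-Reasoning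
    ascend : ∀ k x → bound ≤ k + rank x → ¬ rank x < rank (f x)
    ascend zero    x b≤ lt = ℕₚ.<⇒≱ lt (ℕₚ.≤-trans (rank≤ (f x)) b≤)
    ascend (suc k) x b≤ lt = ascend k (f x) (begin
      bound              ≤⟨ b≤ ⟩
      suc k + rank x     ≡⟨ ℕₚ.+-suc k (rank x) ⟨
      k + suc (rank x)   ≤⟨ ℕₚ.+-monoʳ-≤ k lt ⟩
      k + rank (f x)     ∎) (f-mono lt)

-- Twin classes, the vicinal order and lifts in a levelled ring

module LevelledGraph {c ℓ p : Level} (R : Ring c ℓ) (T : ℕ) (L : Levelling {c} {ℓ} {p} R T) where

  open Levelling L
  open ZeroDivisorGraph R
  open Automorphism
  open Ring R using (_≈_; _-_; +-group)
  private
    module R = Ring R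
    module Tw = IsEquivalence Twin-isEquivalence

  level : Z* → ℕ
  level x = proj₁ (classify x)

  colour : Z* → Colour
  colour x = proj₁ (proj₂ (classify x))

  classified : ∀ x → Typed (level x) (colour x) x
  classified x = proj₂ (proj₂ (classify x))

  private
    variable
      m n : ℕ
      α β γ : Colour
      x y z a b : Z*

  Meets : ℕ → Colour → ℕ → Colour → Set
  Meets m α n β = T < m + n ⊎ m + n ≡ T × β ≡ dual m α

  Meets-sym : Meets m α n β → Meets n β m α
  Meets-sym {m} {α} {n} (inj₁ T<m+n) = inj₁ (subst (T <_) (ℕₚ.+-comm m n) T<m+n)
  Meets-sym {m} {α} {n} (inj₂ (eq , refl)) =
    inj₂ (trans (ℕₚ.+-comm n m) eq , sym (dual-involutive α eq))

  -- Reversibility on vertices comes from the symmetry of `Meets`, hence from `dual` being inverse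
  -- to itself between complementary levels.
  annihilates-sym : Annihilates x y → Annihilates y x
  annihilates-sym {x} {y} = annihilates⁺ (classified y) (classified x)
    ∘ Meets-sym ∘ annihilates⁻ (classified x) (classified y)

  annihilates-respˡ : Twin x y → Annihilates x z → Annihilates y z
  annihilates-respˡ {z = z} (twin p _) = proj₁ p {z}

  annihilates-respʳ : Twin x y → Annihilates z x → Annihilates z y
  annihilates-respʳ {z = z} (twin _ q) = proj₁ q {z}

  Typed⇒⊆ : Typed m α x → Typed m α y → Annihilates x z → Annihilates y z
  Typed⇒⊆ {z = z} u v = annihilates⁺ v (classified z) ∘ annihilates⁻ u (classified z)

  annihilates-⊆⇒Twin : (∀ z → Annihilates x z → Annihilates y z) →
                       (∀ z → Annihilates y z → Annihilates x z) → Twin x y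
  annihilates-⊆⇒Twin {x} {y} x⊆y y⊆x = twin
    ((λ {z} → x⊆y z) , (λ {z} → y⊆x z))
    ( (λ {z} → annihilates-sym {y} {z} ∘ x⊆y z ∘ annihilates-sym {z} {x})
    , (λ {z} → annihilates-sym {x} {z} ∘ y⊆x z ∘ annihilates-sym {z} {y}))

  Typed⇒Twin : Typed m α x → Typed m α y → Twin x y
  Typed⇒Twin {x = x} {y} u v =
    annihilates-⊆⇒Twin (λ z → Typed⇒⊆ {x = x} {y} {z} u v) (λ z → Typed⇒⊆ {x = y} {x} {z} v u)

  top⇒annihilates : Typed (suc T) α x → ∀ z → Annihilates x z
  top⇒annihilates u z = annihilates⁺ u (classified z) (inj₁ (ℕₚ.m≤m+n (suc T) (level z)))

  top⇒Twin : Typed (suc T) α x → Typed (suc T) β y → Twin x y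
  top⇒Twin u v = annihilates-⊆⇒Twin (λ z _ → top⇒annihilates v z) (λ z _ → top⇒annihilates u z)

  -- If m < n, then at level T - m every vertex annihilates y, whereas only those of colour
  -- `dual m α` annihilate x; any other colour tells x and y apart.
  Twin⇒level-≮ : Typed m α x → Typed n β y → Twin x y → ¬ m < n
  Twin⇒level-≮ {m} {α} {x} {n} {β} {y} u v x~y m<n =
    let k+m≡T = ℕₚ.m∸n+n≡m m≤T
        γ , γ≢ , _ = third-colour (dual m α) (dual m α)
        z , w = inhabited γ (ℕₚ.m∸n≤m T m)
        xz = annihilates-respˡ {y} {x} {z} (Tw.sym x~y) (annihilates⁺ v w (inj₁ (begin-strict
               T             ≡⟨ k+m≡T ⟨
               T ∸ m + m     <⟨ ℕₚ.+-monoʳ-< (T ∸ m) m<n ⟩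
               T ∸ m + n     ≡⟨ ℕₚ.+-comm (T ∸ m) n ⟩
               n + (T ∸ m)   ∎)))
    in absurd γ≢ (annihilates⁻ u w xz)
    where
    open ℕₚ.≤-Reasoning
    m≤T : m ≤ T
    m≤T = s≤s⁻¹ (ℕₚ.≤-trans m<n (Typed⇒≤ v))
    absurd : ∀ {γ} → γ ≢ dual m α → ¬ Meets m α (T ∸ m) γ
    absurd γ≢ (inj₁ T<) = ℕₚ.<-irrefl (sym (ℕₚ.m+[n∸m]≡n m≤T)) T<
    absurd γ≢ (inj₂ (_ , eq)) = γ≢ eq

  Twin⇒level-≡ : Typed m α x → Typed n β y → Twin x y → m ≡ n
  Twin⇒level-≡ {m} {n = n} u v x~y with ℕₚ.<-cmp m n
  ... | tri< m<n _ _ = contradiction m<n (Twin⇒level-≮ u v x~y)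
  ... | tri≈ _ m≡n _ = m≡n
  ... | tri> _ _ n<m = contradiction n<m (Twin⇒level-≮ v u (Tw.sym x~y))

  -- x annihilates the dual colour at level T - m, so y does too. Hence both colours have the same
  -- dual, and `dual` is invertible.
  Twin⇒colour-≡ : m ≤ T → Typed m α x → Typed m β y → Twin x y → α ≡ β
  Twin⇒colour-≡ {m} {α} {x} {β} {y} m≤T u v x~y =
    let m+k≡T = ℕₚ.m+[n∸m]≡n m≤T
        z , w = inhabited (dual m α) (ℕₚ.m∸n≤m T m)
        yz = annihilates-respˡ {x} {y} {z} x~y (annihilates⁺ u w (inj₂ (m+k≡T , refl)))
    in compare m+k≡T (annihilates⁻ v w yz)
    where
    compare : m + (T ∸ m) ≡ T → Meets m β (T ∸ m) (dual m α) → α ≡ β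
    compare m+k≡T (inj₁ T<) = contradiction T< (ℕₚ.<-irrefl (sym m+k≡T))
    compare m+k≡T (inj₂ (_ , eq)) =
      trans (sym (dual-involutive α m+k≡T)) (trans (cong (dual (T ∸ m)) eq) (dual-involutive β m+k≡T))

  -- At the last level a twin class does not determine a colour, but its possible leaders agree in
  -- the ring.
  Twin⇒leader-≈ : Typed m α x → Typed n β y → Twin x y → leader m α ≈ leader n β
  Twin⇒leader-≈ {m} u v x~y with Twin⇒level-≡ u v x~y
  ... | refl with ℕₚ.m≤n⇒m<n∨m≡n (Typed⇒≤ u)
  ...   | inj₁ m<1+T = R.reflexive (cong (leader m) (Twin⇒colour-≡ (s≤s⁻¹ m<1+T) u v x~y))
  ...   | inj₂ refl  = top-unique u v

  Twin? : ∀ x y → Dec (Twin x y)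
  Twin? x y with level x ℕₚ.≟ level y
  ... | no lx≢ly = no (lx≢ly ∘ Twin⇒level-≡ (classified x) (classified y))
  ... | yes lx≡ly with ℕₚ.m≤n⇒m<n∨m≡n (Typed⇒≤ (classified y))
  ...   | inj₂ ly≡1+T = yes (top⇒Twin
    (subst (λ m → Typed m (colour x) x) (trans lx≡ly ly≡1+T) (classified x))
    (subst (λ m → Typed m (colour y) y) ly≡1+T (classified y)))
  ...   | inj₁ ly<1+T with subst (λ m → Typed m (colour x) x) lx≡ly (classified x) | colour x ≟ colour y
  ...     | u | no cx≢cy  = no (cx≢cy ∘ Twin⇒colour-≡ (s≤s⁻¹ ly<1+T) u (classified y))
  ...     | u | yes cx≡cy = yes (Typed⇒Twin (subst (λ α → Typed (level y) α x) cx≡cy u) (classified y))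

  annihilates? : ∀ x y → Dec (Annihilates x y)
  annihilates? x y = map′ (annihilates⁺ u v) (annihilates⁻ u v)
    (T ℕₚ.<? level x + level y ⊎-dec
     level x + level y ℕₚ.≟ T ×-dec colour y ≟ dual (level x) (colour x))
    where
    u = classified x
    v = classified y

  -- Orders vertices by level and, within a level, puts those with x² = 0 first. By `rank-<⇒≺` and
  -- `≺⇒rank-<`, comparing ranks is exactly the strict vicinal order, an invariant of Γ-E.
  rank : Z* → ℕ
  rank x = level x + level x + non (annihilates? x x)

  -- The vicinal preorder of Γ-E, and its strict part.
  infix 4 _≼_ _≺_

  _≼_ _≺_ : Rel Z* (c ⊔ ℓ)
  a ≼ b = ∀ x → ¬ Twin x a → ¬ Twin x b → Annihilates x a → Annihilates x b
  a ≺ b = a ≼ b × ¬ b ≼ a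

  -- Annihilating a requires levels adding up to at least T, and replacing a by b makes the sum
  -- exceed T. Strictness is seen on a vertex of the level complementary to that of a.
  level-<⇒≺ : level a < level b → a ≺ b
  level-<⇒≺ {a} {b} la<lb = a≼b , λ b≼a → b⋠a b≼a
    where
    la≤T : level a ≤ T
    la≤T = s≤s⁻¹ (ℕₚ.≤-trans la<lb (Typed⇒≤ (classified b)))

    k = T ∸ level a
    k≤T = ℕₚ.m∸n≤m T (level a)
    k+la≡T = ℕₚ.m∸n+n≡m la≤T

    a≼b : a ≼ b
    a≼b x _ _ xa = annihilates⁺ (classified x) (classified b)
      (inj₁ (widen (annihilates⁻ (classified x) (classified a) xa)))
      where
      below = ℕₚ.+-monoʳ-< (level x) la<lb
      widen : Meets (level x) (colour x) (level a) (colour a) → T < level x + level b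
      widen (inj₁ T<)       = ℕₚ.<-trans T< below
      widen (inj₂ (eq , _)) = subst (_< level x + level b) eq below

    -- A colour other than the dual one of a makes z annihilate b but not a. The second colour that
    -- can be avoided keeps z off the class of a or of b, whichever may share its level.
    witness : ∃ λ z → (∃ λ γ → Typed k γ z × γ ≢ dual (level a) (colour a)) × ¬ Twin z a × ¬ Twin z b
    witness with k ℕₚ.≟ level a
    ... | yes k≡la =
      let γ , γ≢dual , γ≢ca = third-colour (dual (level a) (colour a)) (colour a)
          z , w = inhabited γ k≤T
      in z , (γ , w , γ≢dual)
       , γ≢ca ∘ Twin⇒colour-≡ la≤T (subst (λ m → Typed m γ z) k≡la w) (classified a)
       , λ z~b → ℕₚ.<⇒≢ la<lb (trans (sym k≡la) (Twin⇒level-≡ w (classified b) z~b))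
    ... | no k≢la =
      let γ , γ≢dual , γ≢cb = third-colour (dual (level a) (colour a)) (colour b)
          z , w = inhabited γ k≤T
      in z , (γ , w , γ≢dual)
       , k≢la ∘ Twin⇒level-≡ w (classified a)
       , λ z~b → let k≡lb = Twin⇒level-≡ w (classified b) z~b in
           γ≢cb (Twin⇒colour-≡ (subst (_≤ T) k≡lb k≤T)
                  (subst (λ m → Typed m γ z) k≡lb w) (classified b) z~b)

    b⋠a : ¬ b ≼ a
    b⋠a b≼a with witness
    ... | z , (γ , w , γ≢dual) , z≁a , z≁b =
      absurd (Meets-sym (annihilates⁻ w (classified a) (b≼a z z≁b z≁a
        (annihilates⁺ w (classified b) (inj₁ (subst (_< k + level b) k+la≡T (ℕₚ.+-monoʳ-< k la<lb)))))))
      where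
      absurd : ¬ Meets (level a) (colour a) k γ
      absurd (inj₁ T<)       = ℕₚ.<-irrefl (sym (trans (ℕₚ.+-comm (level a) k) k+la≡T)) T<
      absurd (inj₂ (_ , eq)) = γ≢dual eq

  -- Only the dual colour of a annihilates a at its complementary level, and one colour of that
  -- level lies in one twin class.
  complementary⇒Twin : Typed n β x → Typed n γ y → n + level a ≡ T →
                       Annihilates x a → Annihilates y a → Twin x y
  complementary⇒Twin {n = n} {y = y} {a = a} u v n+la≡T xa ya =
    Typed⇒Twin u (subst (λ γ → Typed n γ y) (trans (dual-colour v ya) (sym (dual-colour u xa))) v)
    where
    dual-colour : ∀ {γ z} → Typed n γ z → Annihilates z a → γ ≡ dual (level a) (colour a)
    dual-colour w za with Meets-sym (annihilates⁻ w (classified a) za)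
    ... | inj₁ T<      = contradiction T< (ℕₚ.<-irrefl (sym (trans (ℕₚ.+-comm (level a) n) n+la≡T)))
    ... | inj₂ (_ , p) = p

  -- If the level of a were above T/2, then b² = 0 as well; so it equals T/2 and the class of a is
  -- dual to itself. Vertices annihilating a at that level are then twins of a, which `≼`
  -- disregards.
  loop<⇒≺ : level a ≡ level b → Annihilates a a → ¬ Annihilates b b → a ≺ b
  loop<⇒≺ {a} {b} la≡lb aa ¬bb = a≼b , b⋠a
    where
    la+la≡T : level a + level a ≡ T
    la+la≡T with annihilates⁻ (classified a) (classified a) aa
    ... | inj₁ T<       = contradiction
          (annihilates⁺ (classified b) (classified b) (inj₁ (subst (λ m → T < m + m) la≡lb T<))) ¬bb
    ... | inj₂ (eq , _) = eq

    a≼b : a ≼ b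
    a≼b x x≁a _ xa with annihilates⁻ (classified x) (classified a) xa
    ... | inj₁ T<       = annihilates⁺ (classified x) (classified b)
                            (inj₁ (subst (λ m → T < level x + m) la≡lb T<))
    ... | inj₂ (eq , _) = contradiction
      (complementary⇒Twin {a = a} (classified x)
        (subst (λ m → Typed m (colour a) a) la≡lx (classified a)) eq xa aa) x≁a
      where
      la≡lx = ℕₚ.+-cancelʳ-≡ (level a) (level a) (level x) (trans la+la≡T (sym eq))

    b⋠a : ¬ b ≼ a
    b⋠a b≼a = d≁a (complementary⇒Twin {a = a} w (classified a) la+la≡T (b≼a d d≁b d≁a db) aa)
      where
      b′ : Typed (level a) (colour b) b
      b′ = subst (λ m → Typed m (colour b) b) (sym la≡lb) (classified b)
      -- The class dual to b differs from those of a and b, annihilates b and does not annihilate a.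
      d,w = inhabited (dual (level a) (colour b)) (ℕₚ.m+n≤o⇒m≤o (level a) (ℕₚ.≤-reflexive la+la≡T))
      d = proj₁ d,w
      w = proj₂ d,w
      db : Annihilates d b
      db = annihilates⁺ w b′ (Meets-sym (inj₂ (la+la≡T , refl)))
      d≁b : ¬ Twin d b
      d≁b d~b = ¬bb (annihilates-respˡ {d} {b} {b} d~b db)
      d≁a : ¬ Twin d a
      d≁a d~a = ¬bb (annihilates-respˡ {a} {b} {b}
        (complementary⇒Twin {a = a} (classified a) b′ la+la≡T aa (annihilates-sym {a} {b} ab)) ab)
        where
        ab : Annihilates a b
        ab = annihilates-respˡ {d} {a} {b} d~a db

  rank-<⇒≺ : rank a < rank b → a ≺ b
  rank-<⇒≺ {a} {b} lt with 2*+non-<⇒ (annihilates? a a) (annihilates? b b) lt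
  ... | inj₁ la<lb              = level-<⇒≺ la<lb
  ... | inj₂ (la≡lb , aa , ¬bb) = loop<⇒≺ {a} {b} la≡lb aa ¬bb

  -- When the levels of y and b add up to T, let d have the level of y and the colour dual to a. If
  -- `a ≼ b` applies to d, then d and y both annihilate b at the complementary level, so they are
  -- twins and y annihilates a. If d is a twin of a or of b, then y is a twin of b or of a
  -- respectively, which is excluded.
  rank-≡⇒≼-sym : rank a ≡ rank b → a ≼ b → b ≼ a
  rank-≡⇒≼-sym {a} {b} eq a≼b y y≁b y≁a yb
    with 2*+non-≡⇒ (annihilates? a a) (annihilates? b b) eq
       | annihilates⁻ (classified y) (classified b) yb
  ... | la≡lb , _ , _ | inj₁ T< =
    annihilates⁺ (classified y) (classified a) (inj₁ (subst (λ m → T < level y + m) (sym la≡lb) T<))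
  ... | la≡lb , aa⇒bb , _ | inj₂ (ly+lb≡T , _) = by-cases (Twin? d a) (Twin? d b)
    where
    ly+la≡T : level y + level a ≡ T
    ly+la≡T = trans (cong (λ k → level y + k) la≡lb) ly+lb≡T
    d,w = inhabited (dual (level a) (colour a)) (ℕₚ.m+n≤o⇒m≤o (level y) (ℕₚ.≤-reflexive ly+la≡T))
    d = proj₁ d,w
    w : Typed (level y) (dual (level a) (colour a)) d
    w = proj₂ d,w
    da : Annihilates d a
    da = annihilates⁺ w (classified a)
      (Meets-sym (inj₂ (trans (ℕₚ.+-comm (level a) (level y)) ly+la≡T , refl)))
    by-cases : Dec (Twin d a) → Dec (Twin d b) → Annihilates y a
    by-cases (yes d~a) _ = contradiction (complementary⇒Twin {a = b} (classified y)
        (subst (λ m → Typed m (colour b) b) (sym ly≡lb) (classified b)) ly+lb≡T yb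
        (aa⇒bb (annihilates-respˡ {d} {a} {a} d~a da))) y≁b
      where
      ly≡lb = trans (Twin⇒level-≡ w (classified a) d~a) la≡lb
    by-cases (no _) (yes d~b) = contradiction (complementary⇒Twin {a = b} (classified y)
        (subst (λ m → Typed m (colour a) a) (sym ly≡la) (classified a)) ly+lb≡T yb
        (annihilates-sym {b} {a} (annihilates-respˡ {d} {b} {a} d~b da))) y≁a
      where
      ly≡la = trans (Twin⇒level-≡ w (classified b) d~b) (sym la≡lb)
    by-cases (no d≁a) (no d≁b) = annihilates-respˡ {d} {y} {a}
      (complementary⇒Twin {a = b} w (classified y) ly+lb≡T (a≼b d d≁a d≁b da) yb) da

  ≺⇒rank-< : a ≺ b → rank a < rank b
  ≺⇒rank-< {a} {b} (a≼b , b⋠a) with ℕₚ.<-cmp (rank a) (rank b)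
  ... | tri< lt _ _ = lt
  ... | tri≈ _ eq _ = contradiction (rank-≡⇒≼-sym {a} {b} eq a≼b) b⋠a
  ... | tri> _ _ gt = contradiction a≼b (proj₂ (rank-<⇒≺ {b} {a} gt))

  rank≤ : ∀ x → rank x ≤ suc T + suc T + 1
  rank≤ x = ℕₚ.+-mono-≤ (ℕₚ.+-mono-≤ lx≤ lx≤) (non≤1 (annihilates? x x))
    where
    lx≤ = Typed⇒≤ (classified x)

  module _ (σ : Automorphism Γ-E) where

    open Automorphism σ using () renaming (to to f; from to f⁻¹)

    f-cong : Twin a b → Twin (f a) (f b)
    f-cong = to-cong σ

    f⁻¹-cong : Twin a b → Twin (f⁻¹ a) (f⁻¹ b)
    f⁻¹-cong = from-cong σ

    f-injective : Twin (f a) (f b) → Twin a b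
    f-injective {a} {b} p = Tw.trans (Tw.sym (strictlyInverseʳ σ a))
      (Tw.trans (f⁻¹-cong p) (strictlyInverseʳ σ b))

    f-annihilates : ¬ Twin a b → Annihilates a b → Annihilates (f a) (f b)
    f-annihilates {a} {b} a≁b ab = proj₂ (proj₂ (preserves σ {a} {b}
      (a≁b , (λ a≈b → a≁b (≈ᵥ⇒Twin {a} {b} a≈b)) , ab)))

    f-annihilates⁻ : ¬ Twin a b → Annihilates (f a) (f b) → Annihilates a b
    f-annihilates⁻ {a} {b} a≁b ab = proj₂ (proj₂ (reflects σ {a} {b}
      (fa≁fb , (λ fa≈fb → fa≁fb (≈ᵥ⇒Twin {f a} {f b} fa≈fb)) , ab)))
      where
      fa≁fb = a≁b ∘ f-injective

    -- Away from twins, annihilation is adjacency in Γ-E, and `≼` only looks there.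
    ≼-preserved : a ≼ b → f a ≼ f b
    ≼-preserved {a} {b} a≼b x x≁fa x≁fb xfa =
      annihilates-respˡ {f x′} {x} {f b} fx′~x (f-annihilates x′≁b (a≼b x′ x′≁a x′≁b
        (f-annihilates⁻ x′≁a (annihilates-respˡ {x} {f x′} {f a} (Tw.sym fx′~x) xfa))))
      where
      x′ = f⁻¹ x
      fx′~x : Twin (f x′) x
      fx′~x = strictlyInverseˡ σ x
      x′≁a : ¬ Twin x′ a
      x′≁a p = x≁fa (Tw.trans (Tw.sym fx′~x) (f-cong p))
      x′≁b : ¬ Twin x′ b
      x′≁b p = x≁fb (Tw.trans (Tw.sym fx′~x) (f-cong p))

    ≼-reflected : f a ≼ f b → a ≼ b
    ≼-reflected {a} {b} fa≼fb x x≁a x≁b xa = f-annihilates⁻ x≁b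
      (fa≼fb (f x) (x≁a ∘ f-injective) (x≁b ∘ f-injective) (f-annihilates x≁a xa))

    rank-mono : rank a < rank b → rank (f a) < rank (f b)
    rank-mono {a} {b} lt = let a≼b , b⋠a = rank-<⇒≺ {a} {b} lt in
      ≺⇒rank-< {f a} {f b} (≼-preserved {a} {b} a≼b , b⋠a ∘ ≼-reflected {b} {a})

    image-rank-≤ : ∀ x → rank (f x) ≤ rank x
    image-rank-≤ x = ℕₚ.≮⇒≥ (rank-≮-image rank _ rank≤ f (λ {x} {y} → rank-mono {x} {y}) x)

  Twin⇒rank-≡ : Twin a b → rank a ≡ rank b
  Twin⇒rank-≡ {a} {b} a~b with Twin⇒level-≡ (classified a) (classified b) a~b
                             | annihilates? a a | annihilates? b b
  ... | la≡lb | yes _ | yes _  = cong (λ m → m + m + 0) la≡lb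
  ... | la≡lb | no _  | no _   = cong (λ m → m + m + 1) la≡lb
  ... | _     | yes aa | no ¬bb = contradiction
    (annihilates-respˡ {a} {b} {b} a~b (annihilates-respʳ {a} {b} {a} a~b aa)) ¬bb
  ... | _     | no ¬aa | yes bb = contradiction
    (annihilates-respˡ {b} {a} {a} (Tw.sym a~b) (annihilates-respʳ {b} {a} {b} (Tw.sym a~b) bb)) ¬aa

  private
    module Aut-Γ = Group (Aut Γ)
    module Aut-Γ-E = Group (Aut Γ-E)

  -- σ and its inverse are both strictly monotone for `rank`, so neither can raise it.
  rank-invariant : ∀ σ x → rank (to σ x) ≡ rank x
  rank-invariant σ x = ℕₚ.≤-antisym (image-rank-≤ σ x) (begin
    rank x                    ≡⟨ Twin⇒rank-≡ (strictlyInverseʳ σ x) ⟨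
    rank (from σ (to σ x))    ≤⟨ image-rank-≤ (σ Aut-Γ-E.⁻¹) (to σ x) ⟩
    rank (to σ x)             ∎)
    where open ℕₚ.≤-Reasoning

  level-invariant : ∀ σ x → level (to σ x) ≡ level x
  level-invariant σ x =
    proj₁ (2*+non-≡⇒ (annihilates? (to σ x) (to σ x)) (annihilates? x x) (rank-invariant σ x))

  -- Between non-twins this is adjacency in Γ-E. Between twins it says a² = 0, for which Γ-E has no
  -- edge but which `rank` remembers.
  annihilates-preserved : ∀ σ {a b} → Annihilates a b → Annihilates (to σ a) (to σ b)
  annihilates-preserved σ {a} {b} ab with Twin? a b
  ... | no a≁b  = f-annihilates σ a≁b ab
  ... | yes a~b = annihilates-respʳ {to σ a} {to σ b} {to σ a} (to-cong σ a~b)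
    (loop (annihilates-respʳ {b} {a} {a} (Tw.sym a~b) ab))
    where
    loop : Annihilates a a → Annihilates (to σ a) (to σ a)
    loop = proj₁ (proj₂ (2*+non-≡⇒ (annihilates? a a) (annihilates? (to σ a) (to σ a))
      {m = level a} {n = level (to σ a)} (sym (rank-invariant σ a))))

  annihilates-reflected : ∀ σ {a b} → Annihilates (to σ a) (to σ b) → Annihilates a b
  annihilates-reflected σ {a} {b} =
      annihilates-respˡ {from σ (to σ a)} {a} {b} (strictlyInverseʳ σ a)
    ∘ annihilates-respʳ {from σ (to σ b)} {b} {from σ (to σ a)} (strictlyInverseʳ σ b)
    ∘ annihilates-preserved (σ Aut-Γ-E.⁻¹) {to σ a} {to σ b}

  leaderOf : Z* → R.Carrier
  leaderOf x = leader (level x) (colour x)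

  leaderOf-cong : Twin x y → leaderOf x ≈ leaderOf y
  leaderOf-cong {x} {y} = Twin⇒leader-≈ (classified x) (classified y)

  private
    move : ∀ σ x → ∃ λ z → Typed (level x) (colour (to σ x)) z ×
                           proj₁ z ≈ (proj₁ x - leaderOf x) R.+ leader (level x) (colour (to σ x))
    move σ x = translate (classified x)
      (subst (λ m → Typed m (colour (to σ x)) (to σ x)) (level-invariant σ x) (classified (to σ x)))

  lift-to : Automorphism Γ-E → Z* → Z*
  lift-to σ x = proj₁ (move σ x)

  lift-to-Twin : ∀ σ x → Twin (lift-to σ x) (to σ x)
  lift-to-Twin σ x = Typed⇒Twin (proj₁ (proj₂ (move σ x)))
    (subst (λ m → Typed m (colour (to σ x)) (to σ x)) (level-invariant σ x) (classified (to σ x)))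

  lift-to-≈ : ∀ σ x → proj₁ (lift-to σ x) ≈ (proj₁ x - leaderOf x) R.+ leaderOf (to σ x)
  lift-to-≈ σ x = R.trans (proj₂ (proj₂ (move σ x)))
    (R.+-congˡ (R.reflexive (cong (λ m → leader m (colour (to σ x))) (sym (level-invariant σ x)))))

  private
    open GroupProperties +-group using (//-rightDividesˡ; //-rightDividesʳ)

    cancel-leaders : Twin y x → (proj₁ x - leaderOf x) R.+ leaderOf y ≈ proj₁ x
    cancel-leaders {y} {x} y~x = R.trans (R.+-congˡ (leaderOf-cong y~x)) (//-rightDividesˡ (leaderOf x) (proj₁ x))

    lift-to-cong : ∀ {σ τ} → σ Aut-Γ-E.≈ τ → ∀ {x y} → proj₁ x ≈ proj₁ y →
                   proj₁ (lift-to σ x) ≈ proj₁ (lift-to τ y)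
    lift-to-cong {σ} {τ} σ≈τ {x} {y} x≈y = begin
      proj₁ (lift-to σ x)                          ≈⟨ lift-to-≈ σ x ⟩
      (proj₁ x - leaderOf x) R.+ leaderOf (to σ x) ≈⟨ R.+-cong (R.+-cong x≈y (R.-‿cong (leaderOf-cong x~y)))
                                                        (leaderOf-cong (Tw.trans (σ≈τ x) (to-cong τ x~y))) ⟩
      (proj₁ y - leaderOf y) R.+ leaderOf (to τ y) ≈⟨ lift-to-≈ τ y ⟨
      proj₁ (lift-to τ y)                          ∎
      where
      open SetoidReasoning R.setoid
      x~y : Twin x y
      x~y = ≈ᵥ⇒Twin {x} {y} x≈y

    -- The first lift replaces the leader of x by that of τ x and keeps the rest; the second finds
    -- that same leader and removes it. Hence lifting is multiplicative.
    lift-to-∘ : ∀ σ τ x → proj₁ (lift-to σ (lift-to τ x)) ≈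
                          (proj₁ x - leaderOf x) R.+ leaderOf (to σ (to τ x))
    lift-to-∘ σ τ x = begin
      proj₁ (lift-to σ w)
        ≈⟨ lift-to-≈ σ w ⟩
      (proj₁ w - leaderOf w) R.+ leaderOf (to σ w)
        ≈⟨ R.+-cong (R.+-cong (lift-to-≈ τ x) (R.-‿cong (leaderOf-cong w~τx)))
                    (leaderOf-cong (to-cong σ w~τx)) ⟩
      (d R.+ leaderOf (to τ x) - leaderOf (to τ x)) R.+ leaderOf (to σ (to τ x))
        ≈⟨ R.+-congʳ (//-rightDividesʳ (leaderOf (to τ x)) d) ⟩
      d R.+ leaderOf (to σ (to τ x))
        ∎
      where
      open SetoidReasoning R.setoid
      w = lift-to τ x
      w~τx = lift-to-Twin τ x
      d = proj₁ x - leaderOf x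

    lift-to-inverse : ∀ σ τ → (∀ x → Twin (to σ (to τ x)) x) →
                      ∀ x → proj₁ (lift-to σ (lift-to τ x)) ≈ proj₁ x
    lift-to-inverse σ τ στ~id x = R.trans (lift-to-∘ σ τ x) (cancel-leaders (στ~id x))

    lift-annihilates⁺ : ∀ σ {a b} → Annihilates a b → Annihilates (lift-to σ a) (lift-to σ b)
    lift-annihilates⁺ σ {a} {b} =
        annihilates-respˡ {to σ a} {lift-to σ a} {lift-to σ b} (Tw.sym (lift-to-Twin σ a))
      ∘ annihilates-respʳ {to σ b} {lift-to σ b} {to σ a} (Tw.sym (lift-to-Twin σ b))
      ∘ annihilates-preserved σ {a} {b}

    lift-annihilates⁻ : ∀ σ {a b} → Annihilates (lift-to σ a) (lift-to σ b) → Annihilates a b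
    lift-annihilates⁻ σ {a} {b} =
        annihilates-reflected σ {a} {b}
      ∘ annihilates-respˡ {lift-to σ a} {to σ a} {to σ b} (lift-to-Twin σ a)
      ∘ annihilates-respʳ {lift-to σ b} {to σ b} {lift-to σ a} (lift-to-Twin σ b)

  lift : Automorphism Γ-E → Automorphism Γ
  lift σ = record
    { bijection = record
      { to        = lift-to σ
      ; from      = lift-to σ⁻¹
      ; to-cong   = λ {x} {y} → σ-cong {x} {y}
      ; from-cong = λ {x} {y} → lift-to-cong {σ⁻¹} {σ⁻¹} (λ _ → Tw.refl) {x} {y}
      ; inverse   =
          (λ {x} {y} p → R.trans (σ-cong {y} {lift-to σ⁻¹ x} p)
            (lift-to-inverse σ σ⁻¹ (strictlyInverseˡ σ) x))
        , (λ {x} {y} p → R.trans (lift-to-cong {σ⁻¹} {σ⁻¹} (λ _ → Tw.refl) {y} {lift-to σ x} p) (σ⁻¹σ x))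
      }
    ; preserves = λ {a} {b} (a≉b , ab) →
        (λ p → a≉b (R.trans (R.sym (σ⁻¹σ a)) (R.trans
          (lift-to-cong {σ⁻¹} {σ⁻¹} (λ _ → Tw.refl) {lift-to σ a} {lift-to σ b} p) (σ⁻¹σ b))))
      , lift-annihilates⁺ σ {a} {b} ab
    ; reflects  = λ {a} {b} (σa≉σb , σaσb) → σa≉σb ∘ σ-cong {a} {b} , lift-annihilates⁻ σ {a} {b} σaσb
    }
    where
    σ⁻¹ = σ Aut-Γ-E.⁻¹
    σ-cong : ∀ {x y} → proj₁ x ≈ proj₁ y → proj₁ (lift-to σ x) ≈ proj₁ (lift-to σ y)
    σ-cong {x} {y} = lift-to-cong {σ} {σ} (λ _ → Tw.refl) {x} {y}
    σ⁻¹σ : ∀ x → proj₁ (lift-to σ⁻¹ (lift-to σ x)) ≈ proj₁ x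
    σ⁻¹σ = lift-to-inverse σ⁻¹ σ (strictlyInverseʳ σ)

  lift-isGroupHomomorphism :
    IsGroupHomomorphism (Group.rawGroup (Aut Γ-E)) (Group.rawGroup (Aut Γ)) lift
  lift-isGroupHomomorphism = record
    { isMonoidHomomorphism = record
      { isMagmaHomomorphism = record
        { isRelHomomorphism = record { cong = λ {σ} {τ} p x → lift-to-cong {σ} {τ} p {x} {x} R.refl }
        ; homo = λ σ τ x → R.trans (lift-to-≈ (σ Aut-Γ-E.∙ τ) x) (R.sym (lift-to-∘ σ τ x))
        }
      ; ε-homo = λ x → R.trans (lift-to-≈ Aut-Γ-E.ε x) (cancel-leaders Tw.refl)
      }
    ; ⁻¹-homo = λ _ _ → R.refl
    }

module _ {c ℓ p : Level} (R : Ring c ℓ) (_≈?_ : Decidable (Ring._≈_ R))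
         (twinned : ∀ a → HasOtherTwinOrIsTop R a)
         (T : ℕ) (L : Levelling {c} {ℓ} {p} R T) where

  open ZeroDivisorGraph R
  open InducedAutomorphism R _≈?_ twinned
  open LevelledGraph R T L
  private
    module R = Ring R
    module Tw = IsEquivalence Twin-isEquivalence

  splitExtension : SplitExtension Reg (Aut Γ) (Aut Γ-E)
  splitExtension = record
    { ι      = proj₁
    ; π      = induced
    ; σ      = lift
    ; ι-mono = record
      { isGroupHomomorphism = record
        { isMonoidHomomorphism = record
          { isMagmaHomomorphism = record
            { isRelHomomorphism = record { cong = λ p → p }
            ; homo              = λ _ _ _ → R.refl
            }
          ; ε-homo = λ _ → R.refl
          }
        ; ⁻¹-homo = λ _ _ → R.refl
        }
      ; injective = λ p → p
      }
    ; π-hom  = induced-isGroupHomomorphism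
    ; σ-hom  = lift-isGroupHomomorphism
    ; π∘σ≈id = lift-to-Twin
    ; π∘ι≈ε  = λ (_ , regular) a → Tw.sym (regular a)
    -- Inducing the identity on Γ-E means, by definition, moving each vertex within its twin class.
    ; kernel = λ φ trivial → (φ , λ a → Tw.sym (trivial a)) , λ _ → R.refl
    }

  -- Γ′ is determined by unification with the goal, and only then identified with Γ: for a
  -- concrete ring, comparing Aut Γ with Aut Γ′ directly would unfold all the ring laws.
  Aut-Γ≅Reg⋊Aut-Γ-E : {Γ′ : Digraph (c ⊔ ℓ) ℓ ℓ} ⦃ _ : Γ′ ≡ Γ ⦄ →
                      Σ[ θ ∈ GroupAction (Aut Γ-E) Reg ] Aut Γ′ ≅ (Reg ⋊[ θ ] Aut Γ-E)
  Aut-Γ≅Reg⋊Aut-Γ-E ⦃ refl ⦄ = SplitExtension⇒⋊ splitExtension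

-- The filtration of the integral quaternions

open QuaternionOperations ℤₚ.+-*-commutativeRing using (_⊕_; _⊛_; ⊖_; 0ℍ; 1ℍ)
open Quaternion

ℍ : Set
ℍ = Quaternion ℤ

infixl 6 _⊝_
infixl 7 _·_

_⊝_ : ℍ → ℍ → ℍ
x ⊝ y = x ⊕ ⊖ y

_·_ : ℤ → ℍ → ℍ
n · quat a b c d = quat (n *ᶻ a) (n *ᶻ b) (n *ᶻ c) (n *ᶻ d)

dbl : ℍ → ℍ
dbl = + 2 ·_

conj : ℍ → ℍ
conj (quat a b c d) = quat a (-ᶻ b) (-ᶻ c) (-ᶻ d)

quat-cong : ∀ {a b c d a′ b′ c′ d′ : ℤ} → a ≡ a′ → b ≡ b′ → c ≡ c′ → d ≡ d′ →
            quat a b c d ≡ quat a′ b′ c′ d′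
quat-cong refl refl refl refl = refl

-- Quaternion identities by reflection of coordinates

module Symbolic (n : ℕ) where

  ℍₑ = Quaternion (Expr ℤ n)

  infixl 6 _:-_ _:⊕_ _:⊝_
  infixl 7 _:⊛_ _:·_

  two : Expr ℤ n
  two = Κ (+ 2)

  _:-_ : Expr ℤ n → Expr ℤ n → Expr ℤ n
  a :- b = a :+ :- b

  _:⊕_ _:⊝_ _:⊛_ : ℍₑ → ℍₑ → ℍₑ
  quat a b c d :⊕ quat a′ b′ c′ d′ = quat (a :+ a′) (b :+ b′) (c :+ c′) (d :+ d′)
  quat a b c d :⊝ quat a′ b′ c′ d′ = quat (a :- a′) (b :- b′) (c :- c′) (d :- d′)
  quat a b c d :⊛ quat a′ b′ c′ d′ = quat
    (a :* a′ :- b :* b′ :- c :* c′ :- d :* d′)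
    (a :* b′ :+ b :* a′ :+ c :* d′ :- d :* c′)
    (a :* c′ :- b :* d′ :+ c :* a′ :+ d :* b′)
    (a :* d′ :+ b :* c′ :- c :* b′ :+ d :* a′)

  _:·_ : Expr ℤ n → ℍₑ → ℍₑ
  e :· quat a b c d = quat (e :* a) (e :* b) (e :* c) (e :* d)

  :conj :⊖_ :dbl :even₁ :even₂ : ℍₑ → ℍₑ
  :conj (quat a b c d) = quat a (:- b) (:- c) (:- d)
  :⊖ quat a b c d = quat (:- a) (:- b) (:- c) (:- d)

  :dbl x = two :· x
  :even₁ (quat a b c d) = quat a b c (a :+ b :+ c :+ two :* d)
  :even₂ (quat a b c d) = quat a (a :+ two :* b) (a :+ two :* c) (a :+ two :* d)

  :⟨_⟩ : ℍ → ℍₑ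
  :⟨ quat a b c d ⟩ = quat (Κ a) (Κ b) (Κ c) (Κ d)

  ⟦_⟧ ⟦_⇓⟧ : ℍₑ → Vec ℤ n → ℍ
  ⟦ quat a b c d ⟧ ρ = quat (Ops.⟦ a ⟧ ρ) (Ops.⟦ b ⟧ ρ) (Ops.⟦ c ⟧ ρ) (Ops.⟦ d ⟧ ρ)
  ⟦ quat a b c d ⇓⟧ ρ = quat (Ops.⟦ a ⇓⟧ ρ) (Ops.⟦ b ⇓⟧ ρ) (Ops.⟦ c ⇓⟧ ρ) (Ops.⟦ d ⇓⟧ ρ)

  correct : ∀ p ρ → ⟦ p ⇓⟧ ρ ≡ ⟦ p ⟧ ρ
  correct (quat a b c d) ρ =
    quat-cong (Ops.correct a ρ) (Ops.correct b ρ) (Ops.correct c ρ) (Ops.correct d ρ)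

  solveℍ : ∀ ρ p q → ⟦ p ⇓⟧ ρ ≡ ⟦ q ⇓⟧ ρ → ⟦ p ⟧ ρ ≡ ⟦ q ⟧ ρ
  solveℍ ρ p q eq = trans (sym (correct p ρ)) (trans eq (correct q ρ))

coords : ℍ → Vec ℤ 4
coords (quat a b c d) = a ∷ b ∷ c ∷ d ∷ []

module _ where
  open Symbolic 4

  X₄ : ℍₑ
  X₄ = quat (Ι (# 0)) (Ι (# 1)) (Ι (# 2)) (Ι (# 3))

module _ where
  open Symbolic 8

  X₈ Y₈ : ℍₑ
  X₈ = quat (Ι (# 0)) (Ι (# 1)) (Ι (# 2)) (Ι (# 3))
  Y₈ = quat (Ι (# 4)) (Ι (# 5)) (Ι (# 6)) (Ι (# 7))

module _ where
  open Symbolic 12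

  X₁₂ Y₁₂ Z₁₂ : ℍₑ
  X₁₂ = quat (Ι (# 0)) (Ι (# 1)) (Ι (# 2)) (Ι (# 3))
  Y₁₂ = quat (Ι (# 4)) (Ι (# 5)) (Ι (# 6)) (Ι (# 7))
  Z₁₂ = quat (Ι (# 8)) (Ι (# 9)) (Ι (# 10)) (Ι (# 11))

-- Doubling and the chain J

dbl-⊕ : ∀ x y → dbl (x ⊕ y) ≡ dbl x ⊕ dbl y
dbl-⊕ x y = solveℍ (coords x ++ coords y) (:dbl (X₈ :⊕ Y₈)) (:dbl X₈ :⊕ :dbl Y₈) refl
  where open Symbolic 8

dbl-⊖ : ∀ x → dbl (⊖ x) ≡ ⊖ dbl x
dbl-⊖ x = solveℍ (coords x) (:dbl (:⊖ X₄)) (:⊖ :dbl X₄) refl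
  where open Symbolic 4

dbl-⊝ : ∀ x y → dbl (x ⊝ y) ≡ dbl x ⊝ dbl y
dbl-⊝ x y = trans (dbl-⊕ x (⊖ y)) (cong (λ z → dbl x ⊕ z) (dbl-⊖ y))

dbl-⊛ˡ : ∀ x y → dbl x ⊛ y ≡ dbl (x ⊛ y)
dbl-⊛ˡ x y = solveℍ (coords x ++ coords y) (:dbl X₈ :⊛ Y₈) (:dbl (X₈ :⊛ Y₈)) refl
  where open Symbolic 8

dbl-⊛ʳ : ∀ x y → x ⊛ dbl y ≡ dbl (x ⊛ y)
dbl-⊛ʳ x y = solveℍ (coords x ++ coords y) (X₈ :⊛ :dbl Y₈) (:dbl (X₈ :⊛ Y₈)) refl
  where open Symbolic 8

dbl-· : ∀ n x → n · dbl x ≡ dbl (n · x)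
dbl-· n x = solveℍ (n ∷ coords x) (Ι (# 0) :· :dbl X) (:dbl (Ι (# 0) :· X)) refl
  where
  open Symbolic 5
  X = quat (Ι (# 1)) (Ι (# 2)) (Ι (# 3)) (Ι (# 4))

dbl-injective : ∀ {x y} → dbl x ≡ dbl y → x ≡ y
dbl-injective eq = quat-cong (cancel (cong re eq)) (cancel (cong im-i eq))
                             (cancel (cong im-j eq)) (cancel (cong im-k eq))
  where
  cancel : ∀ {a b} → + 2 *ᶻ a ≡ + 2 *ᶻ b → a ≡ b
  cancel = ℤₚ.*-cancelˡ-≡ (+ 2) _ _

-- Parametrisations of M and I: in the first the last coordinate has the parity of the sum of the
-- others, in the second all coordinates have the parity of the first.
even₁ even₂ : ℍ → ℍ
even₁ (quat a b c d) = quat a b c (a +ᶻ b +ᶻ c +ᶻ + 2 *ᶻ d)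
even₂ (quat a b c d) = quat a (a +ᶻ + 2 *ᶻ b) (a +ᶻ + 2 *ᶻ c) (a +ᶻ + 2 *ᶻ d)

-- Coordinates on J m, where J 0 = M, J 1 = I and J (2k + m) = 2ᵏ J m.
basis : ℕ → ℍ → ℍ
basis 0             = even₁
basis 1             = even₂
basis (suc (suc m)) = dbl ∘ basis m

-- Records rather than ∃, so that m and x can be inferred.
record J (m : ℕ) (x : ℍ) : Set where
  constructor _,_
  field
    coordinates : ℍ
    x≡basis     : x ≡ basis m coordinates

basis-⊕ : ∀ m p q → basis m (p ⊕ q) ≡ basis m p ⊕ basis m q
basis-⊕ 0 p q = solveℍ (coords p ++ coords q) (:even₁ (X₈ :⊕ Y₈)) (:even₁ X₈ :⊕ :even₁ Y₈) refl
  where open Symbolic 8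
basis-⊕ 1 p q = solveℍ (coords p ++ coords q) (:even₂ (X₈ :⊕ Y₈)) (:even₂ X₈ :⊕ :even₂ Y₈) refl
  where open Symbolic 8
basis-⊕ (suc (suc m)) p q = trans (cong dbl (basis-⊕ m p q)) (dbl-⊕ (basis m p) (basis m q))

basis-⊖ : ∀ m p → basis m (⊖ p) ≡ ⊖ basis m p
basis-⊖ 0 p = solveℍ (coords p) (:even₁ (:⊖ X₄)) (:⊖ :even₁ X₄) refl
  where open Symbolic 4
basis-⊖ 1 p = solveℍ (coords p) (:even₂ (:⊖ X₄)) (:⊖ :even₂ X₄) refl
  where open Symbolic 4
basis-⊖ (suc (suc m)) p = trans (cong dbl (basis-⊖ m p)) (dbl-⊖ (basis m p))

J-⊕ : ∀ {m x y} → J m x → J m y → J m (x ⊕ y)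
J-⊕ {m} (p , refl) (q , refl) = p ⊕ q , sym (basis-⊕ m p q)

J-⊖ : ∀ {m x} → J m x → J m (⊖ x)
J-⊖ {m} (p , refl) = ⊖ p , sym (basis-⊖ m p)

J-⊝ : ∀ {m x y} → J m x → J m y → J m (x ⊝ y)
J-⊝ u v = J-⊕ u (J-⊖ v)

J-dbl : ∀ {m x} → J m x → J (2 + m) (dbl x)
J-dbl (p , eq) = p , cong dbl eq

J-dbl⁻¹ : ∀ {m x} → J (2 + m) (dbl x) → J m x
J-dbl⁻¹ (p , eq) = p , dbl-injective eq

J-0ℍ : ∀ m → J m 0ℍ
J-0ℍ 0             = 0ℍ , refl
J-0ℍ 1             = 0ℍ , refl
J-0ℍ (suc (suc m)) = J-dbl (J-0ℍ m)

-- The inclusions I ⊂ M and 2M ⊂ I suffice, the others being their doubles; P rewrites the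
-- coordinates.
basis-suc : ∀ m p → J m (basis (suc m) p)
basis-suc 0 p = _ , solveℍ (coords p) (:even₂ X₄) (:even₁ (P X₄)) refl
  where
  open Symbolic 4
  P : ℍₑ → ℍₑ
  P (quat a b c d) = quat a (a :+ two :* b) (a :+ two :* c) (d :- a :- b :- c)
basis-suc 1 p = _ , solveℍ (coords p) (:dbl (:even₁ X₄)) (:even₂ (P X₄)) refl
  where
  open Symbolic 4
  P : ℍₑ → ℍₑ
  P (quat a b c d) = quat (two :* a) (b :- a) (c :- a) (b :+ c :+ two :* d)
basis-suc (suc (suc m)) p = J-dbl (basis-suc m p)

J-suc : ∀ {m x} → J (suc m) x → J m x
J-suc {m} (p , refl) = basis-suc m p

J-≤ : ∀ {m n x} → m ≤ n → J n x → J m x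
J-≤ m≤n = descend (ℕₚ.≤⇒≤′ m≤n)
  where
  descend : ∀ {m n x} → m ≤′ n → J n x → J m x
  descend ≤′-refl       = λ u → u
  descend (≤′-step m≤n) = descend m≤n ∘ J-suc

-- The coordinates of the products of basis elements were found by computer algebra.
basis-⊛ : ∀ m n p q → J (suc (m + n)) (basis m p ⊛ basis n q)
basis-⊛ 0 0 p q = _ , solveℍ (coords p ++ coords q) (:even₁ X₈ :⊛ :even₁ Y₈) (:even₂ (P X₈ Y₈)) refl
  where
  open Symbolic 8
  P : ℍₑ → ℍₑ → ℍₑ
  P (quat a b c d) (quat a′ b′ c′ d′) = quat
    (re (:even₁ X₈ :⊛ :even₁ Y₈))
    (a :* (b′ :+ d′) :+ b :* (a′ :+ b′ :+ d′)
      :+ c :* (a′ :+ b′ :+ c′ :+ two :* d′) :+ d :* (a′ :+ b′ :+ two :* d′))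
    (a :* (b′ :+ c′ :+ d′) :+ b :* b′
      :+ c :* (a′ :+ b′ :+ c′ :+ d′) :+ d :* (a′ :+ two :* b′ :+ c′ :+ two :* d′))
    (a :* (a′ :+ b′ :+ c′ :+ two :* d′) :+ b :* (a′ :+ b′ :+ c′ :+ d′)
      :+ c :* (a′ :+ c′ :+ d′) :+ d :* (two :* a′ :+ b′ :+ c′ :+ two :* d′))
basis-⊛ 0 1 p q = _ , solveℍ (coords p ++ coords q) (:even₁ X₈ :⊛ :even₂ Y₈) (:dbl (:even₁ (P X₈ Y₈))) refl
  where
  open Symbolic 8
  P : ℍₑ → ℍₑ → ℍₑ
  P (quat a b c d) (quat a′ b′ c′ d′) = quat
    (:- (a :* d′) :- b :* (a′ :+ b′ :+ d′) :- c :* (a′ :+ c′ :+ d′) :- d :* (a′ :+ two :* d′))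
    (a :* (b′ :- c′) :- b :* c′ :+ c :* (d′ :- c′) :- d :* (a′ :+ two :* c′))
    (a :* (a′ :+ b′ :+ c′) :+ b :* (b′ :- d′) :+ c :* (a′ :+ b′) :+ d :* (a′ :+ two :* b′))
    (a :* (d′ :- b′) :+ b :* (a′ :+ c′ :+ d′) :+ c :* (c′ :- b′) :+ d :* (a′ :+ c′ :+ d′ :- b′))
basis-⊛ 1 0 p q = _ , solveℍ (coords p ++ coords q) (:even₂ X₈ :⊛ :even₁ Y₈) (:dbl (:even₁ (P X₈ Y₈))) refl
  where
  open Symbolic 8
  P : ℍₑ → ℍₑ → ℍₑ
  P (quat a b c d) (quat a′ b′ c′ d′) = quat
    (:- (a :* (b′ :+ c′ :+ d′)) :- b :* b′ :- c :* c′ :- d :* (a′ :+ b′ :+ c′ :+ two :* d′))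
    (a :* (a′ :+ b′ :+ d′) :+ b :* a′ :+ c :* (a′ :+ b′ :+ c′ :+ two :* d′) :- d :* c′)
    (:- (a :* d′) :- b :* (a′ :+ b′ :+ c′ :+ two :* d′) :+ c :* a′ :+ d :* b′)
    (a :* (c′ :+ d′) :+ b :* (b′ :+ c′ :+ d′) :- c :* (a′ :+ b′ :+ d′) :+ d :* (a′ :+ c′ :+ d′))
basis-⊛ 1 1 p q = _ , solveℍ (coords p ++ coords q) (:even₂ X₈ :⊛ :even₂ Y₈) (:dbl (:even₂ (P X₈ Y₈))) refl
  where
  open Symbolic 8
  P : ℍₑ → ℍₑ → ℍₑ
  P (quat a b c d) (quat a′ b′ c′ d′) = quat
    (:- (a :* (a′ :+ b′ :+ c′ :+ d′)) :- b :* (a′ :+ two :* b′)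
      :- c :* (a′ :+ two :* c′) :- d :* (a′ :+ two :* d′))
    (a :* (a′ :+ b′ :+ d′) :+ b :* (a′ :+ b′) :+ c :* (a′ :+ c′ :+ d′) :+ d :* (d′ :- c′))
    (a :* (a′ :+ b′ :+ c′) :+ b :* (b′ :- d′) :+ c :* (a′ :+ c′) :+ d :* (a′ :+ b′ :+ d′))
    (a :* (a′ :+ c′ :+ d′) :+ b :* (a′ :+ b′ :+ c′) :+ c :* (c′ :- b′) :+ d :* (a′ :+ d′))
basis-⊛ (suc (suc m)) n p q = subst (J _) (sym (dbl-⊛ˡ (basis m p) (basis n q))) (J-dbl (basis-⊛ m n p q))
basis-⊛ 0 (suc (suc n)) p q = subst (J _) (sym (dbl-⊛ʳ (even₁ p) (basis n q))) (J-dbl (basis-⊛ 0 n p q))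
basis-⊛ 1 (suc (suc n)) p q = subst (J _) (sym (dbl-⊛ʳ (even₂ p) (basis n q))) (J-dbl (basis-⊛ 1 n p q))

-- `J m` is the trace of the power m + 1 of the maximal ideal, whence the extra 1.
J-⊛ : ∀ {m n x y} → J m x → J n y → J (suc (m + n)) (x ⊛ y)
J-⊛ {m} {n} (p , refl) (q , refl) = basis-⊛ m n p q

-- Powers of two in the filtration

dbls : ℕ → ℍ → ℍ
dbls zero    x = x
dbls (suc s) x = dbl (dbls s x)

-- Divisibility by 2^s through repeated doubling, so that its recursion runs parallel to that of
-- `J`.
record Div (s : ℕ) (x : ℍ) : Set where
  constructor _,_
  field
    quotient : ℍ
    x≡dbls   : x ≡ dbls s quotient

Div-dbl : ∀ {s x} → Div s x → Div (suc s) (dbl x)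
Div-dbl (y , eq) = y , cong dbl eq

Div-dbl⁻¹ : ∀ {s x} → Div (suc s) (dbl x) → Div s x
Div-dbl⁻¹ (y , eq) = y , dbl-injective eq

twice : ℕ → ℕ
twice zero    = zero
twice (suc s) = suc (suc (twice s))

J⇒Div : ∀ s {x} → J (twice s) x → Div s x
J⇒Div zero    {x} _     = x , refl
J⇒Div (suc s) (p , refl) = Div-dbl (J⇒Div s (p , refl))

-- This is 2ℤ⁴ ⊂ I, scaled by 2^s. With `J⇒Div` it places 2^(s+1)ℤ⁴ between J (2 + 2s) and J (1 +
-- 2s), so that modulo 2^(s+1) the last level is 1 + 2s.
Div⇒J : ∀ s {x} → Div (suc s) x → J (suc (twice s)) x
Div⇒J zero (y , refl) = _ , solveℍ (coords y) (:dbl X₄) (:even₂ (P X₄)) refl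
  where
  open Symbolic 4
  P : ℍₑ → ℍₑ
  P (quat a b c d) = quat (two :* a) (b :- a) (c :- a) (d :- a)
Div⇒J (suc s) (y , refl) = J-dbl (Div⇒J s (y , refl))

-- Deciding membership in the filtration

halve? : ∀ x → Dec (∃ λ y → x ≡ dbl y)
halve? (quat a b c d) with + 2 ∣? a ×-dec + 2 ∣? b ×-dec + 2 ∣? c ×-dec + 2 ∣? d
... | yes (divides a p , divides b q , divides c r , divides d s) = yes (quat a b c d , quat-cong
  (trans p (ℤₚ.*-comm a (+ 2))) (trans q (ℤₚ.*-comm b (+ 2)))
  (trans r (ℤₚ.*-comm c (+ 2))) (trans s (ℤₚ.*-comm d (+ 2))))
... | no ¬p = no λ { (quat a b c d , refl) → ¬p
  ( divides a (ℤₚ.*-comm (+ 2) a) , divides b (ℤₚ.*-comm (+ 2) b)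
  , divides c (ℤₚ.*-comm (+ 2) c) , divides d (ℤₚ.*-comm (+ 2) d)) }

private
  ≡+2* : ∀ s e {q} → e -ᶻ s ≡ q *ᶻ + 2 → e ≡ s +ᶻ + 2 *ᶻ q
  ≡+2* s e {q} eq = trans (lemma s e) (cong (λ z → s +ᶻ z) (trans eq (ℤₚ.*-comm q (+ 2))))
    where
    lemma : ∀ s e → e ≡ s +ᶻ (e -ᶻ s)
    lemma = ℤ-Solver.solve-∀

  +2*-≡ : ∀ s d → s +ᶻ + 2 *ᶻ d -ᶻ s ≡ d *ᶻ + 2
  +2*-≡ = ℤ-Solver.solve-∀

J? : ∀ m x → Dec (J m x)
J? 0 (quat a b c e) with + 2 ∣? e -ᶻ (a +ᶻ b +ᶻ c)
... | yes (divides d eq) = yes (quat a b c d , quat-cong refl refl refl (≡+2* (a +ᶻ b +ᶻ c) e eq))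
... | no ¬p = no λ { (quat a b c d , refl) → ¬p (divides d (+2*-≡ (a +ᶻ b +ᶻ c) d)) }
J? 1 (quat a b c d) with + 2 ∣? b -ᶻ a ×-dec + 2 ∣? c -ᶻ a ×-dec + 2 ∣? d -ᶻ a
... | yes (divides p eq , divides q eq′ , divides r eq″) =
  yes (quat a p q r , quat-cong refl (≡+2* a b eq) (≡+2* a c eq′) (≡+2* a d eq″))
... | no ¬p = no λ { (quat a p q r , refl) → ¬p
  (divides p (+2*-≡ a p) , divides q (+2*-≡ a q) , divides r (+2*-≡ a r)) }
J? (suc (suc m)) x with halve? x
... | no ¬h          = no λ { (p , eq) → ¬h (basis m p , eq) }
... | yes (y , refl) = map′ J-dbl J-dbl⁻¹ (J? m y)

Div? : ∀ s x → Dec (Div s x)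
Div? zero    x = yes (x , refl)
Div? (suc s) x with halve? x
... | no ¬h          = no λ { (p , eq) → ¬h (dbls s p , eq) }
... | yes (y , refl) = map′ Div-dbl Div-dbl⁻¹ (Div? s y)

-- Representatives of the three nonzero classes of J m modulo J (1 + m).
leader : ℕ → Colour → ℍ
leader 0             0F = quat 1ℤ 1ℤ 0ℤ 0ℤ
leader 0             1F = quat 1ℤ 0ℤ 1ℤ 0ℤ
leader 0             2F = quat 1ℤ 0ℤ 0ℤ 1ℤ
leader 1             0F = quat (+ 2) 0ℤ 0ℤ 0ℤ
leader 1             1F = quat -1ℤ 1ℤ 1ℤ 1ℤ
leader 1             2F = quat 1ℤ 1ℤ 1ℤ 1ℤ
leader (suc (suc m)) α  = dbl (leader m α)

-- The colours are the elements of 𝔽₄ˣ.  For odd m, dual m is inversion; for even m it is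
-- composed with the Frobenius automorphism, which is inversion too.
dual : ℕ → Colour → Colour
dual 0 α              = α
dual 1 0F             = 0F
dual 1 1F             = 2F
dual 1 2F             = 1F
dual (suc (suc m)) α  = dual m α

-- Leaders and their products

leader∈J : ∀ m α → J m (leader m α)
leader∈J 0 α = from-yes (all? (λ α → J? 0 (leader 0 α))) α
leader∈J 1 α = from-yes (all? (λ α → J? 1 (leader 1 α))) α
leader∈J (suc (suc m)) α = J-dbl (leader∈J m α)

leader∉J : ∀ m α → ¬ J (suc m) (leader m α)
leader∉J 0 α = from-yes (all? (λ α → ¬? (J? 1 (leader 0 α)))) α
leader∉J 1 α = from-yes (all? (λ α → ¬? (J? 2 (leader 1 α)))) α
leader∉J (suc (suc m)) α = leader∉J m α ∘ J-dbl⁻¹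

-- Levels behave like a valuation: the product of two leaders has level exactly 1 + m + n. Each pair
-- m, n below 2 leaves nine products to compute; doubling gives the rest.
leader-⊛∉J : ∀ m n α β → ¬ J (2 + (m + n)) (leader m α ⊛ leader n β)
leader-⊛∉J 0 0 α β = from-yes (all? λ α → all? λ β → ¬? (J? 2 (leader 0 α ⊛ leader 0 β))) α β
leader-⊛∉J 0 1 α β = from-yes (all? λ α → all? λ β → ¬? (J? 3 (leader 0 α ⊛ leader 1 β))) α β
leader-⊛∉J 1 0 α β = from-yes (all? λ α → all? λ β → ¬? (J? 3 (leader 1 α ⊛ leader 0 β))) α β
leader-⊛∉J 1 1 α β = from-yes (all? λ α → all? λ β → ¬? (J? 4 (leader 1 α ⊛ leader 1 β))) α β
leader-⊛∉J (suc (suc m)) n α β =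
  leader-⊛∉J m n α β ∘ J-dbl⁻¹ ∘ subst (J _) (dbl-⊛ˡ (leader m α) (leader n β))
leader-⊛∉J 0 (suc (suc n)) α β =
  leader-⊛∉J 0 n α β ∘ J-dbl⁻¹ ∘ subst (J _) (dbl-⊛ʳ (leader 0 α) (leader n β))
leader-⊛∉J 1 (suc (suc n)) α β =
  leader-⊛∉J 1 n α β ∘ J-dbl⁻¹ ∘ subst (J _) (dbl-⊛ʳ (leader 1 α) (leader n β))

-- An even sum forces m and n to have the same parity, so one involution is applied twice.
dual-involutive : ∀ t m n α → m + n ≡ twice t → dual n (dual m α) ≡ α
dual-involutive t 0 0 α eq = refl
dual-involutive zero    0 1 α ()
dual-involutive (suc t) 0 1 α ()
dual-involutive zero    1 0 α ()
dual-involutive (suc t) 1 0 α ()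
dual-involutive t 1 1 0F eq = refl
dual-involutive t 1 1 1F eq = refl
dual-involutive t 1 1 2F eq = refl
dual-involutive (suc t) (suc (suc m)) n α eq =
  dual-involutive t m n α (ℕₚ.suc-injective (ℕₚ.suc-injective eq))
dual-involutive (suc t) 0 (suc (suc n)) α eq =
  dual-involutive t 0 n α (ℕₚ.suc-injective (ℕₚ.suc-injective eq))
dual-involutive (suc t) 1 (suc (suc n)) α eq =
  dual-involutive t 1 n α (ℕₚ.suc-injective (ℕₚ.suc-injective eq))

-- The product has level 1 + 2t, where exactly one of the three classes consists of multiples of
-- 2^(t+1). For each α a single β leads to that class. The levels (0, 0) and (1, 1) are computed;
-- the others follow by doubling.
leader-⊛-Div⇔ : ∀ t m n α β → m + n ≡ twice t →
  (Div (suc t) (leader m α ⊛ leader n β) → β ≡ dual m α) ×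
  (β ≡ dual m α → Div (suc t) (leader m α ⊛ leader n β))
leader-⊛-Div⇔ zero 0 0 α β eq = from-yes (all? λ α → all? λ β →
  (Div? 1 (leader 0 α ⊛ leader 0 β) →-dec β ≟ α) ×-dec
  (β ≟ α →-dec Div? 1 (leader 0 α ⊛ leader 0 β))) α β
leader-⊛-Div⇔ (suc zero) 1 1 α β eq = from-yes (all? λ α → all? λ β →
  (Div? 2 (leader 1 α ⊛ leader 1 β) →-dec β ≟ dual 1 α) ×-dec
  (β ≟ dual 1 α →-dec Div? 2 (leader 1 α ⊛ leader 1 β))) α β
leader-⊛-Div⇔ (suc t) (suc (suc m)) n α β eq =
  let f , g = leader-⊛-Div⇔ t m n α β (ℕₚ.suc-injective (ℕₚ.suc-injective eq))
      eq′ = dbl-⊛ˡ (leader m α) (leader n β) in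
  f ∘ Div-dbl⁻¹ ∘ subst (Div _) eq′ , subst (Div _) (sym eq′) ∘ Div-dbl ∘ g
leader-⊛-Div⇔ (suc t) 0 (suc (suc n)) α β eq =
  let f , g = leader-⊛-Div⇔ t 0 n α β (ℕₚ.suc-injective (ℕₚ.suc-injective eq))
      eq′ = dbl-⊛ʳ (leader 0 α) (leader n β) in
  f ∘ Div-dbl⁻¹ ∘ subst (Div _) eq′ , subst (Div _) (sym eq′) ∘ Div-dbl ∘ g
leader-⊛-Div⇔ (suc t) 1 (suc (suc n)) α β eq =
  let f , g = leader-⊛-Div⇔ t 1 n α β (ℕₚ.suc-injective (ℕₚ.suc-injective eq))
      eq′ = dbl-⊛ʳ (leader 1 α) (leader n β) in
  f ∘ Div-dbl⁻¹ ∘ subst (Div _) eq′ , subst (Div _) (sym eq′) ∘ Div-dbl ∘ g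

-- Multiples of a power of two

dbls-⊕ : ∀ s x y → dbls s x ⊕ dbls s y ≡ dbls s (x ⊕ y)
dbls-⊕ zero    x y = refl
dbls-⊕ (suc s) x y = trans (sym (dbl-⊕ (dbls s x) (dbls s y))) (cong dbl (dbls-⊕ s x y))

dbls-⊖ : ∀ s x → ⊖ dbls s x ≡ dbls s (⊖ x)
dbls-⊖ zero    x = refl
dbls-⊖ (suc s) x = trans (sym (dbl-⊖ (dbls s x))) (cong dbl (dbls-⊖ s x))

dbls-⊛ˡ : ∀ s x y → dbls s x ⊛ y ≡ dbls s (x ⊛ y)
dbls-⊛ˡ zero    x y = refl
dbls-⊛ˡ (suc s) x y = trans (dbl-⊛ˡ (dbls s x) y) (cong dbl (dbls-⊛ˡ s x y))

dbls-⊛ʳ : ∀ s x y → x ⊛ dbls s y ≡ dbls s (x ⊛ y)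
dbls-⊛ʳ zero    x y = refl
dbls-⊛ʳ (suc s) x y = trans (dbl-⊛ʳ x (dbls s y)) (cong dbl (dbls-⊛ʳ s x y))

Div-⊕ : ∀ {s x y} → Div s x → Div s y → Div s (x ⊕ y)
Div-⊕ {s} (p , refl) (q , refl) = p ⊕ q , dbls-⊕ s p q

Div-⊖ : ∀ {s x} → Div s x → Div s (⊖ x)
Div-⊖ {s} (p , refl) = ⊖ p , dbls-⊖ s p

Div-⊝ : ∀ {s x y} → Div s x → Div s y → Div s (x ⊝ y)
Div-⊝ u v = Div-⊕ u (Div-⊖ v)

Div-⊛ˡ : ∀ {s x} y → Div s x → Div s (x ⊛ y)
Div-⊛ˡ {s} y (p , refl) = p ⊛ y , dbls-⊛ˡ s p y

Div-⊛ʳ : ∀ {s} x {y} → Div s y → Div s (x ⊛ y)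
Div-⊛ʳ {s} x (p , refl) = x ⊛ p , dbls-⊛ʳ s x p

-- Residues of J m modulo J (1 + m)

parity : ∀ z → (∃ λ h → z ≡ + 2 *ᶻ h) ⊎ (∃ λ h → z ≡ 1ℤ +ᶻ + 2 *ᶻ h)
parity z with z %ℕ 2 | n%ℕd<d z 2 | a≡a%ℕn+[a/ℕn]*n z 2
... | 0 | _ | eq = inj₁ (z /ℕ 2 , trans eq (trans (ℤₚ.+-identityˡ _) (ℤₚ.*-comm (z /ℕ 2) (+ 2))))
... | 1 | _ | eq = inj₂ (z /ℕ 2 , trans eq (cong (λ q → 1ℤ +ᶻ q) (ℤₚ.*-comm (z /ℕ 2) (+ 2))))
... | suc (suc _) | s≤s (s≤s ()) | _

compare₂ : ∀ a b → (∃ λ h → b ≡ a +ᶻ + 2 *ᶻ h) ⊎ (∃ λ h → b ≡ a +ᶻ (1ℤ +ᶻ + 2 *ᶻ h))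
compare₂ a b with parity (b -ᶻ a)
... | inj₁ (h , eq) = inj₁ (h , trans (lemma a b) (cong (λ e → a +ᶻ e) eq))
  where
  lemma : ∀ a b → b ≡ a +ᶻ (b -ᶻ a)
  lemma = ℤ-Solver.solve-∀
... | inj₂ (h , eq) = inj₂ (h , trans (lemma a b) (cong (λ e → a +ᶻ e) eq))
  where
  lemma : ∀ a b → b ≡ a +ᶻ (b -ᶻ a)
  lemma = ℤ-Solver.solve-∀

-- Two parities fix the residue: for M, those of b - a and c - a; for I, in its own coordinates,
-- those of a and of b + c + d.
basis-split : ∀ m p → J (suc m) (basis m p) ⊎ (∃ λ α → J (suc m) (basis m p ⊝ leader m α))
basis-split 0 (quat a b c d) = by-residue (compare₂ a b) (compare₂ a c)
  where
  open Symbolic 4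
  one A P Q D : Expr ℤ 4
  one = Κ 1ℤ; A = re X₄; P = im-i X₄; Q = im-j X₄; D = im-k X₄
  by-residue : ∀ {a b c d} →
    (∃ λ h → b ≡ a +ᶻ + 2 *ᶻ h) ⊎ (∃ λ h → b ≡ a +ᶻ (1ℤ +ᶻ + 2 *ᶻ h)) →
    (∃ λ h → c ≡ a +ᶻ + 2 *ᶻ h) ⊎ (∃ λ h → c ≡ a +ᶻ (1ℤ +ᶻ + 2 *ᶻ h)) →
    J 1 (even₁ (quat a b c d)) ⊎ (∃ λ α → J 1 (even₁ (quat a b c d) ⊝ leader 0 α))
  by-residue {a} {d = d} (inj₁ (p , refl)) (inj₁ (q , refl)) = inj₁ (_ , solveℍ (a ∷ p ∷ q ∷ d ∷ [])
    (:even₁ (quat A (A :+ two :* P) (A :+ two :* Q) D))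
    (:even₂ (quat A P Q (A :+ P :+ Q :+ D))) refl)
  by-residue {a} {d = d} (inj₁ (p , refl)) (inj₂ (q , refl)) = inj₂ (0F , _ , solveℍ (a ∷ p ∷ q ∷ d ∷ [])
    (:even₁ (quat A (A :+ two :* P) (A :+ (one :+ two :* Q)) D) :⊝ :⟨ leader 0 0F ⟩)
    (:even₂ (quat (A :- one) P (Q :+ one) (A :+ one :+ P :+ Q :+ D))) refl)
  by-residue {a} {d = d} (inj₂ (p , refl)) (inj₁ (q , refl)) = inj₂ (1F , _ , solveℍ (a ∷ p ∷ q ∷ d ∷ [])
    (:even₁ (quat A (A :+ (one :+ two :* P)) (A :+ two :* Q) D) :⊝ :⟨ leader 0 1F ⟩)
    (:even₂ (quat (A :- one) (P :+ one) Q (A :+ one :+ P :+ Q :+ D))) refl)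
  by-residue {a} {d = d} (inj₂ (p , refl)) (inj₂ (q , refl)) = inj₂ (2F , _ , solveℍ (a ∷ p ∷ q ∷ d ∷ [])
    (:even₁ (quat A (A :+ (one :+ two :* P)) (A :+ (one :+ two :* Q)) D) :⊝ :⟨ leader 0 2F ⟩)
    (:even₂ (quat (A :- one) (P :+ one) (Q :+ one) (A :+ one :+ P :+ Q :+ D))) refl)
basis-split 1 (quat a b c d) = by-residue (parity a) (compare₂ (b +ᶻ c) d)
  where
  open Symbolic 4
  one P B C H : Expr ℤ 4
  one = Κ 1ℤ; P = re X₄; B = im-i X₄; C = im-j X₄; H = im-k X₄
  by-residue : ∀ {a b c d} →
    (∃ λ h → a ≡ + 2 *ᶻ h) ⊎ (∃ λ h → a ≡ 1ℤ +ᶻ + 2 *ᶻ h) →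
    (∃ λ h → d ≡ b +ᶻ c +ᶻ + 2 *ᶻ h) ⊎ (∃ λ h → d ≡ b +ᶻ c +ᶻ (1ℤ +ᶻ + 2 *ᶻ h)) →
    J 2 (even₂ (quat a b c d)) ⊎ (∃ λ α → J 2 (even₂ (quat a b c d) ⊝ leader 1 α))
  by-residue {b = b} {c} (inj₁ (p , refl)) (inj₁ (h , refl)) = inj₁ (_ , solveℍ (p ∷ b ∷ c ∷ h ∷ [])
    (:even₂ (quat (two :* P) B C (B :+ C :+ two :* H)))
    (:dbl (:even₁ (quat P (P :+ B) (P :+ C) (H :- P)))) refl)
  by-residue {b = b} {c} (inj₁ (p , refl)) (inj₂ (h , refl)) = inj₂ (0F , _ , solveℍ (p ∷ b ∷ c ∷ h ∷ [])
    (:even₂ (quat (two :* P) B C (B :+ C :+ (one :+ two :* H))) :⊝ :⟨ leader 1 0F ⟩)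
    (:dbl (:even₁ (quat (P :- one) (P :+ B) (P :+ C) (H :+ one :- P)))) refl)
  by-residue {b = b} {c} (inj₂ (p , refl)) (inj₁ (h , refl)) = inj₂ (2F , _ , solveℍ (p ∷ b ∷ c ∷ h ∷ [])
    (:even₂ (quat (one :+ two :* P) B C (B :+ C :+ two :* H)) :⊝ :⟨ leader 1 2F ⟩)
    (:dbl (:even₁ (quat P (P :+ B) (P :+ C) (H :- P)))) refl)
  by-residue {b = b} {c} (inj₂ (p , refl)) (inj₂ (h , refl)) = inj₂ (1F , _ , solveℍ (p ∷ b ∷ c ∷ h ∷ [])
    (:even₂ (quat (one :+ two :* P) B C (B :+ C :+ (one :+ two :* H))) :⊝ :⟨ leader 1 1F ⟩)
    (:dbl (:even₁ (quat (P :+ one) (P :+ B) (P :+ C) (H :- P)))) refl)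
basis-split (suc (suc m)) p with basis-split m p
... | inj₁ u       = inj₁ (J-dbl u)
... | inj₂ (α , u) = inj₂ (α , subst (J _) (dbl-⊝ (basis m p) (leader m α)) (J-dbl u))

J-split : ∀ {m x} → J m x → J (suc m) x ⊎ (∃ λ α → J (suc m) (x ⊝ leader m α))
J-split {m} (p , refl) = basis-split m p

-- Quaternions of odd norm

⊕-⊝-cancel : ∀ x y → x ⊕ y ⊝ y ≡ x
⊕-⊝-cancel x y = solveℍ (coords x ++ coords y) (X₈ :⊕ Y₈ :⊝ Y₈) X₈ refl
  where open Symbolic 8

-- The last coordinate is written so that the coordinate sum is odd. Then the norm N(x) is odd too,
-- and w is (N(x) - 1) / 2.
odd-norm : ∀ a b c d y → let x = quat a b c (a +ᶻ b +ᶻ c +ᶻ (1ℤ +ᶻ + 2 *ᶻ d)) in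
           ∃ λ w → conj x ⊛ (x ⊛ y) ≡ y ⊕ dbl (w · y) × y ⊛ x ⊛ conj x ≡ y ⊕ dbl (w · y)
odd-norm a b c d y = Ops.⟦ W ⟧ ρ , solveℍ ρ (:conj X :⊛ (X :⊛ Y₈)) (Y₈ :⊕ :dbl (W :· Y₈)) refl
                       , solveℍ ρ (Y₈ :⊛ X :⊛ :conj X) (Y₈ :⊕ :dbl (W :· Y₈)) refl
  where
  open Symbolic 8
  ρ = a ∷ b ∷ c ∷ d ∷ coords y
  A B C D one W : Expr ℤ 8
  A = re X₈; B = im-i X₈; C = im-j X₈; D = im-k X₈; one = Κ 1ℤ
  X : ℍₑ
  X = quat A B C (A :+ B :+ C :+ (one :+ two :* D))
  W = A :* (one :+ A :+ B :+ C :+ two :* D) :+ B :* (one :+ B :+ C :+ two :* D)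
      :+ C :* (one :+ C :+ two :* D) :+ two :* D :* (one :+ D)

-- Solving for y shows it to be a double 2y′, and halving the hypothesis gives the same hypothesis
-- on y′ with a smaller exponent.
odd-cancel-Div : ∀ s w {y} → Div s (y ⊕ dbl (w · y)) → Div s y
odd-cancel-Div zero    w {y} _       = y , refl
odd-cancel-Div (suc s) w {y} (z , eq) =
  subst (Div _) 2y′≡y (Div-dbl (odd-cancel-Div s w (z , dbl-injective eq′)))
  where
  open ≡-Reasoning
  y′ = dbls s z ⊝ w · y
  2y′≡y : dbl y′ ≡ y
  2y′≡y = begin
    dbl (dbls s z ⊝ w · y)             ≡⟨ dbl-⊝ (dbls s z) (w · y) ⟩
    dbl (dbls s z) ⊝ dbl (w · y)       ≡⟨ cong (_⊝ dbl (w · y)) eq ⟨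
    y ⊕ dbl (w · y) ⊝ dbl (w · y)      ≡⟨ ⊕-⊝-cancel y (dbl (w · y)) ⟩
    y                                  ∎
  eq′ : dbl (y′ ⊕ dbl (w · y′)) ≡ dbl (dbls s z)
  eq′ = begin
    dbl (y′ ⊕ dbl (w · y′))            ≡⟨ dbl-⊕ y′ (dbl (w · y′)) ⟩
    dbl y′ ⊕ dbl (dbl (w · y′))        ≡⟨ cong (λ v → dbl y′ ⊕ dbl v) (dbl-· w y′) ⟨
    dbl y′ ⊕ dbl (w · dbl y′)          ≡⟨ cong (λ v → v ⊕ dbl (w · v)) 2y′≡y ⟩
    y ⊕ dbl (w · y)                    ≡⟨ eq ⟩
    dbl (dbls s z)                     ∎

-- Multiplying by the conjugate of x turns x ⊛ y into N(x) y, and N(x) is odd outside J 0.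
Div-⊛⇒Div : ∀ s x y → Div s (x ⊛ y) ⊎ Div s (y ⊛ x) → ¬ J 0 x → Div s y
Div-⊛⇒Div s (quat a b c e) y xy x∉J with compare₂ (a +ᶻ b +ᶻ c) e
... | inj₁ (d , refl) = contradiction (quat a b c d , refl) x∉J
... | inj₂ (d , refl) = by-norm xy
  where
  x̄ = conj (quat a b c (a +ᶻ b +ᶻ c +ᶻ (1ℤ +ᶻ + 2 *ᶻ d)))
  norm = odd-norm a b c d y
  w = proj₁ norm
  by-norm : _ → Div s y
  by-norm (inj₁ u) = odd-cancel-Div s w (subst (Div s) (proj₁ (proj₂ norm)) (Div-⊛ʳ x̄ u))
  by-norm (inj₂ u) = odd-cancel-Div s w (subst (Div s) (proj₂ (proj₂ norm)) (Div-⊛ˡ x̄ u))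

-- The classes of the last level collapse modulo 2^(s+1): colour 0F joins zero, while 1F and 2F
-- become equal by `top-unique` and stay nonzero by `top-¬Div`.
top-Div : ∀ s → Div (suc s) (leader (suc (twice s)) 0F)
top-Div zero    = 1ℍ , refl
top-Div (suc s) = Div-dbl (top-Div s)

top-¬Div : ∀ s → ¬ Div (suc s) (leader (suc (twice s)) 2F)
top-¬Div zero    = from-no (Div? 1 (leader 1 2F))
top-¬Div (suc s) = top-¬Div s ∘ Div-dbl⁻¹

top-unique : ∀ s → Div (suc s) (leader (suc (twice s)) 1F ⊝ leader (suc (twice s)) 2F)
top-unique zero    = quat -1ℤ 0ℤ 0ℤ 0ℤ , refl
top-unique (suc s) = subst (Div _)
  (dbl-⊝ (leader (suc (twice s)) 1F) (leader (suc (twice s)) 2F)) (Div-dbl (top-unique s))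

-- Leading terms

record Leads (m : ℕ) (α : Colour) (x : ℍ) : Set where
  constructor leads
  field
    remainder∈J : J (suc m) (x ⊝ leader m α)

⊝-⊕-cancel : ∀ x y → x ⊝ y ⊕ y ≡ x
⊝-⊕-cancel x y = solveℍ (coords x ++ coords y) (X₈ :⊝ Y₈ :⊕ Y₈) X₈ refl
  where open Symbolic 8

⊝-⊝-cancel : ∀ x y → x ⊝ (x ⊝ y) ≡ y
⊝-⊝-cancel x y = solveℍ (coords x ++ coords y) (X₈ :⊝ (X₈ :⊝ Y₈)) Y₈ refl
  where open Symbolic 8

⊛-⊝-⊛ : ∀ x y g h → x ⊛ y ⊝ g ⊛ h ≡ (x ⊝ g) ⊛ y ⊕ g ⊛ (y ⊝ h)
⊛-⊝-⊛ x y g h = solveℍ (coords x ++ coords y ++ coords g ++ coords h)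
  (X :⊛ Y :⊝ G :⊛ H) ((X :⊝ G) :⊛ Y :⊕ G :⊛ (Y :⊝ H)) refl
  where
  open Symbolic 16
  X Y G H : ℍₑ
  X = quat (Ι (# 0)) (Ι (# 1)) (Ι (# 2)) (Ι (# 3))
  Y = quat (Ι (# 4)) (Ι (# 5)) (Ι (# 6)) (Ι (# 7))
  G = quat (Ι (# 8)) (Ι (# 9)) (Ι (# 10)) (Ι (# 11))
  H = quat (Ι (# 12)) (Ι (# 13)) (Ι (# 14)) (Ι (# 15))

Leads-leader : ∀ m α → Leads m α (leader m α)
Leads-leader m α = leads (subst (J (suc m)) (sym (⊝-self (leader m α))) (J-0ℍ (suc m)))
  where
  ⊝-self : ∀ x → x ⊝ x ≡ 0ℍ
  ⊝-self x = solveℍ (coords x) (X₄ :⊝ X₄) :⟨ 0ℍ ⟩ refl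
    where open Symbolic 4

Leads⇒J : ∀ {m α x} → Leads m α x → J m x
Leads⇒J {m} {α} {x} (leads u) = subst (J m) (⊝-⊕-cancel x (leader m α)) (J-⊕ (J-suc u) (leader∈J m α))

Leads⇒¬J : ∀ {m α x} → Leads m α x → ¬ J (suc m) x
Leads⇒¬J {m} {α} {x} (leads u) v =
  leader∉J m α (subst (J _) (⊝-⊝-cancel x (leader m α)) (J-⊝ v u))

-- Replacing x or y by its leader changes one factor by an element one level higher, hence the
-- product by one that is negligible here.
Leads-⊛ : ∀ {m n α β x y} → Leads m α x → Leads n β y →
          J (2 + (m + n)) (x ⊛ y ⊝ leader m α ⊛ leader n β)
Leads-⊛ {m} {n} {α} {β} {x} {y} u@(leads u′) v@(leads v′) =
  subst (J (2 + (m + n))) (sym (⊛-⊝-⊛ x y (leader m α) (leader n β)))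
  (J-⊕ (J-⊛ u′ (Leads⇒J v))
       (subst (λ k → J (suc k) (leader m α ⊛ (y ⊝ leader n β))) (ℕₚ.+-suc m n) (J-⊛ (leader∈J m α) v′)))

module _ (s : ℕ) where

  private
    T = twice s

  -- x climbs the chain from J 0 until it drops out. It cannot get to J (2 + T), all of whose
  -- elements are divisible by 2^(s+1).
  Leads-exists : ∀ {x} → J 0 x → ¬ Div (suc s) x → ∃ λ m → ∃ λ α → m ≤ suc T × Leads m α x
  Leads-exists {x} x∈J x≢0 = climb (2 + T) 0 (ℕₚ.+-identityʳ _) x∈J
    where
    -- k counts the steps left before J (2 + T).
    climb : ∀ k m → k + m ≡ 2 + T → J m x → ∃ λ m → ∃ λ α → m ≤ suc T × Leads m α x
    climb zero    m eq u = contradiction (J⇒Div (suc s) (subst (λ m → J m x) eq u)) x≢0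
    climb (suc k) m eq u with J-split u
    ... | inj₁ v       = climb k (suc m) (trans (ℕₚ.+-suc k m) eq) v
    ... | inj₂ (α , v) = m , α , ℕₚ.m+n≤o⇒n≤o k (ℕₚ.≤-reflexive (ℕₚ.suc-injective eq)) , leads v

  private
    module _ {m n α β x y} (u : Leads m α x) (v : Leads n β y) (m+n≡T : m + n ≡ T) where

      Leads-⊛-Div : Div (suc s) (x ⊛ y ⊝ leader m α ⊛ leader n β)
      Leads-⊛-Div = J⇒Div (suc s)
        (subst (λ k → J (2 + k) (x ⊛ y ⊝ leader m α ⊛ leader n β)) m+n≡T (Leads-⊛ u v))

  -- If m + n = T, the product agrees with that of the leaders modulo 2^(s+1). If m + n < T,
  -- divisibility would put it, and hence the product of the leaders, into J (2 + (m + n)), which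
  -- `leader-⊛∉J` forbids.
  Leads-⊛-Div⁻ : ∀ {m n α β x y} → Leads m α x → Leads n β y →
                 Div (suc s) (x ⊛ y) → T < m + n ⊎ m + n ≡ T × β ≡ dual m α
  Leads-⊛-Div⁻ {m} {n} {α} {β} {x} {y} u v xy with ℕₚ.<-cmp (m + n) T
  ... | tri> _ _ T<m+n = inj₁ T<m+n
  ... | tri≈ _ m+n≡T _ = inj₂ (m+n≡T , proj₁ (leader-⊛-Div⇔ s m n α β m+n≡T)
        (subst (Div (suc s)) (⊝-⊝-cancel (x ⊛ y) (leader m α ⊛ leader n β))
          (Div-⊝ xy (Leads-⊛-Div u v m+n≡T))))
  ... | tri< m+n<T _ _ = contradiction
        (subst (J (2 + (m + n))) (⊝-⊝-cancel (x ⊛ y) (leader m α ⊛ leader n β))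
          (J-⊝ (J-≤ (s≤s m+n<T) (Div⇒J s xy)) (Leads-⊛ u v)))
        (leader-⊛∉J m n α β)

  Leads-⊛-Div⁺ : ∀ {m n α β x y} → Leads m α x → Leads n β y →
                 T < m + n ⊎ m + n ≡ T × β ≡ dual m α → Div (suc s) (x ⊛ y)
  Leads-⊛-Div⁺ u v (inj₁ T<m+n) = J⇒Div (suc s) (J-≤ (s≤s T<m+n) (J-⊛ (Leads⇒J u) (Leads⇒J v)))
  Leads-⊛-Div⁺ {m} {n} {α} {β} {x} {y} u v (inj₂ (m+n≡T , β≡)) =
    subst (Div (suc s)) (⊝-⊕-cancel (x ⊛ y) (leader m α ⊛ leader n β))
      (Div-⊕ (Leads-⊛-Div u v m+n≡T) (proj₂ (leader-⊛-Div⇔ s m n α β m+n≡T) β≡))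

-- Lipschitz quaternions modulo a power of two

dbls-· : ∀ s x → dbls s x ≡ + (2 ^ s) · x
dbls-· zero x = quat-cong (sym (ℤₚ.*-identityˡ _)) (sym (ℤₚ.*-identityˡ _))
                          (sym (ℤₚ.*-identityˡ _)) (sym (ℤₚ.*-identityˡ _))
dbls-· (suc s) x = trans (cong dbl (dbls-· s x))
  (quat-cong (power (re x)) (power (im-i x)) (power (im-j x)) (power (im-k x)))
  where
  power : ∀ a → + 2 *ᶻ (+ (2 ^ s) *ᶻ a) ≡ + (2 ^ suc s) *ᶻ a
  power a = trans (sym (ℤₚ.*-assoc (+ 2) (+ (2 ^ s)) a)) (cong (_*ᶻ a) (sym (ℤₚ.pos-* 2 (2 ^ s))))

⊝-identityʳ : ∀ x → x ⊝ 0ℍ ≡ x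
⊝-identityʳ x = quat-cong (ℤₚ.+-identityʳ _) (ℤₚ.+-identityʳ _) (ℤₚ.+-identityʳ _) (ℤₚ.+-identityʳ _)

-- The exponent of the modulus is `suc s`, so that T = 2s and the last level is 1 + 2s.
module LipschitzModPowerOfTwo (s : ℕ) where

  T : ℕ
  T = twice s

  R : Ring 0ℓ 0ℓ
  R = ℤ/ (2 ^ suc s) [i,j,k]

  open Ring R using (_≈_; 0#; setoid) renaming (refl to ≈-refl; sym to ≈-sym; trans to ≈-trans)
  open ZeroDivisorGraph R
  open QuaternionOperations (ℤ/ (2 ^ suc s)) using (quat)
  open Modular (2 ^ suc s) using (congruent)
  module Tw = IsEquivalence Twin-isEquivalence

  private
    N : ℤ
    N = + (2 ^ suc s)

  ≈⇒Div : ∀ {x y} → x ≈ y → Div (suc s) (x ⊝ y)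
  ≈⇒Div (quat (congruent (divides p eq-p)) (congruent (divides q eq-q))
              (congruent (divides r eq-r)) (congruent (divides t eq-t))) =
    quat p q r t , trans (quat-cong (flip-* p eq-p) (flip-* q eq-q) (flip-* r eq-r) (flip-* t eq-t))
                         (sym (dbls-· (suc s) (quat p q r t)))
    where
    flip-* : ∀ {a} q → a ≡ q *ᶻ N → a ≡ N *ᶻ q
    flip-* q eq = trans eq (ℤₚ.*-comm q N)

  Div⇒≈ : ∀ {x y} → Div (suc s) (x ⊝ y) → x ≈ y
  Div⇒≈ {x} {y} (z , eq) = quat
    (congruent (divides (re z)   (flip-* (re z)   (cong re eq′))))
    (congruent (divides (im-i z) (flip-* (im-i z) (cong im-i eq′))))
    (congruent (divides (im-j z) (flip-* (im-j z) (cong im-j eq′))))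
    (congruent (divides (im-k z) (flip-* (im-k z) (cong im-k eq′))))
    where
    eq′ : x ⊝ y ≡ N · z
    eq′ = trans eq (dbls-· (suc s) z)
    flip-* : ∀ {a} q → a ≡ N *ᶻ q → a ≡ q *ᶻ N
    flip-* q eq = trans eq (ℤₚ.*-comm N q)

  ≈0⇒Div : ∀ {x} → x ≈ 0# → Div (suc s) x
  ≈0⇒Div {x} p = subst (Div (suc s)) (⊝-identityʳ x) (≈⇒Div p)

  Div⇒≈0 : ∀ {x} → Div (suc s) x → x ≈ 0#
  Div⇒≈0 {x} u = Div⇒≈ (subst (Div (suc s)) (sym (⊝-identityʳ x)) u)

  _≈?_ : Decidable _≈_
  x ≈? y = map′ Div⇒≈ ≈⇒Div (Div? (suc s) (x ⊝ y))

  ¬Div : (a : Z*) → ¬ Div (suc s) (proj₁ a)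
  ¬Div (_ , a≉0 , _) = a≉0 ∘ Div⇒≈0

  -- An element outside M has odd norm, so it can be cancelled modulo 2^(s+1) on either side.
  zeroDivisor∈J : (a : Z*) → J 0 (proj₁ a)
  zeroDivisor∈J (a , a≉0 , b , b≉0 , ab≈0) with J? 0 a
  ... | yes a∈J = a∈J
  ... | no a∉J  = contradiction (Div⇒≈0 (Div-⊛⇒Div (suc s) a b (Sum.map ≈0⇒Div ≈0⇒Div ab≈0) a∉J)) b≉0

  -- The element 2^s (1 + i + j + k), the single vertex of the last level.
  top : ℍ
  top = leader (suc T) 2F

  -- M times J (1 + T) lies in J (2 + T), so `top` annihilates all of M.
  J⇒Z* : ∀ {x} → J 0 x → ¬ Div (suc s) x → Z*
  J⇒Z* {x} x∈J ¬Div-x = x , ¬Div-x ∘ ≈0⇒Div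
    , top , top-¬Div s ∘ ≈0⇒Div , inj₁ (Div⇒≈0 (J⇒Div (suc s) (J-⊛ x∈J (leader∈J (suc T) 2F))))

  leader-top-≈ : ∀ {α x} → Leads (suc T) α x → ¬ Div (suc s) x → leader (suc T) α ≈ top
  leader-top-≈ {0F} {x} (leads u) ¬Div-x = contradiction
    (subst (Div (suc s)) (⊝-⊕-cancel x (leader (suc T) 0F)) (Div-⊕ (J⇒Div (suc s) u) (top-Div s))) ¬Div-x
  leader-top-≈ {1F} _ _ = Div⇒≈ (top-unique s)
  leader-top-≈ {2F} _ _ = ≈-refl

  Leads-¬Div : ∀ {m α x} → m ≤ T → Leads m α x → ¬ Div (suc s) x
  Leads-¬Div m≤T u v = Leads⇒¬J u (J-≤ (s≤s m≤T) (Div⇒J s v))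

  -- Below the last level `Leads-¬Div` applies. At the last level x and y are both congruent to the
  -- leader modulo 2^(s+1).
  Leads-transfers-¬Div : ∀ {m α x y} → Leads m α x → Leads m α y → ¬ Div (suc s) y → m ≤ suc T → ¬ Div (suc s) x
  Leads-transfers-¬Div {m} {α} {x} {y} u@(leads u′) (leads v′) ¬Div-y m≤1+T Div-x with ℕₚ.m≤n⇒m<n∨m≡n m≤1+T
  ... | inj₁ m<1+T = Leads-¬Div (s≤s⁻¹ m<1+T) u Div-x
  ... | inj₂ refl  = ¬Div-y (subst (Div (suc s)) (⊝-⊕-cancel y l) (Div-⊕ (J⇒Div (suc s) v′)
          (subst (Div (suc s)) (⊝-⊝-cancel x l) (Div-⊝ Div-x (J⇒Div (suc s) u′)))))
    where
    l = leader (suc T) α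

  Leads⇒level≤ : ∀ {m α x} → ¬ Div (suc s) x → Leads m α x → m ≤ suc T
  Leads⇒level≤ {m} ¬Div-x u = s≤s⁻¹ (ℕₚ.≰⇒> λ 2+T≤m → ¬Div-x (J⇒Div (suc s) (J-≤ 2+T≤m (Leads⇒J u))))

  levelling : Levelling R T
  levelling = record
    { dual            = dual
    ; dual-involutive = λ {m} {n} α → dual-involutive s m n α
    ; leader          = leader
    ; Typed           = λ m α x → Leads m α (proj₁ x)
    ; classify        = λ x → let m , α , _ , u = Leads-exists s (zeroDivisor∈J x) (¬Div x) in m , α , u
    ; Typed⇒≤         = λ {_} {_} {x} → Leads⇒level≤ (¬Div x)
    ; inhabited       = λ {m} α m≤T →
        J⇒Z* (J-≤ z≤n (leader∈J m α)) (Leads-¬Div m≤T (Leads-leader m α)) , Leads-leader m α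
    ; annihilates⁻    = λ u v xy → Leads-⊛-Div⁻ s u v (≈0⇒Div xy)
    ; annihilates⁺    = λ u v meets → Div⇒≈0 (Leads-⊛-Div⁺ s u v meets)
    ; translate       = λ {m} {α} {β} {x} {y} → translate {m} {α} {β} {x} {y}
    ; top-unique      = λ {α} {β} {x} {y} u v →
        ≈-trans (leader-top-≈ u (¬Div x)) (≈-sym (leader-top-≈ v (¬Div y)))
    }
    where
    translate : ∀ {m α β} {x y : Z*} → Leads m α (proj₁ x) → Leads m β (proj₁ y) →
                ∃ λ (z : Z*) → Leads m β (proj₁ z) × proj₁ z ≈ proj₁ x ⊝ leader m α ⊕ leader m β
    translate {m} {α} {β} {x} {y} (leads u) v =
      J⇒Z* (J-≤ z≤n (Leads⇒J w)) (Leads-transfers-¬Div w v (¬Div y) (Leads⇒level≤ (¬Div y) v)) , w , ≈-refl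
      where
      w : Leads m β (proj₁ x ⊝ leader m α ⊕ leader m β)
      w = leads (subst (J (suc m)) (sym (⊕-⊝-cancel (proj₁ x ⊝ leader m α) (leader m β))) u)

  open LevelledGraph R T levelling

  ⊕-⊝-cancelˡ : ∀ x y → x ⊕ y ⊝ x ≡ y
  ⊕-⊝-cancelˡ x y = solveℍ (coords x ++ coords y) (X₈ :⊕ Y₈ :⊝ X₈) Y₈ refl
    where open Symbolic 8

  ⊕-⊝-swap : ∀ x y z → x ⊕ y ⊝ z ≡ (x ⊝ z) ⊕ y
  ⊕-⊝-swap x y z = solveℍ (coords x ++ coords y ++ coords z) (X₁₂ :⊕ Y₁₂ :⊝ Z₁₂) ((X₁₂ :⊝ Z₁₂) :⊕ Y₁₂) refl
    where open Symbolic 12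

  -- When m is not the last level, `top` lies in J (suc m), so adding it keeps the leading term.
  Leads⇒hasOtherTwinOrIsTop : ∀ {m α} a → Leads m α (proj₁ a) → m < suc T ⊎ m ≡ suc T →
                              HasOtherTwinOrIsTop R a
  Leads⇒hasOtherTwinOrIsTop {m} {α} a u@(leads u′) (inj₁ m<1+T) =
    inj₁ (a′ , a≉a′ , Typed⇒Twin {m} {α} {a} {a′} u w)
    where
    w : Leads m α (proj₁ a ⊕ top)
    w = leads (subst (J (suc m)) (sym (⊕-⊝-swap (proj₁ a) top (leader m α)))
      (J-⊕ u′ (J-≤ m<1+T (leader∈J (suc T) 2F))))
    a′ : Z*
    a′ = J⇒Z* (J-≤ z≤n (Leads⇒J w)) (Leads-¬Div (s≤s⁻¹ m<1+T) w)
    a≉a′ : ¬ proj₁ a ≈ proj₁ a′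
    a≉a′ p = top-¬Div s (subst (Div (suc s)) (⊕-⊝-cancelˡ (proj₁ a) top) (≈⇒Div (≈-sym p)))
  Leads⇒hasOtherTwinOrIsTop {α = α} a u (inj₂ refl) = inj₂ λ x →
      top⇒annihilates {α} {a} u x
    , annihilates-sym {a} {x} (top⇒annihilates {α} {a} u x)

  hasOtherTwinOrIsTop : ∀ a → HasOtherTwinOrIsTop R a
  hasOtherTwinOrIsTop a = Leads⇒hasOtherTwinOrIsTop a (classified a)
    (ℕₚ.m≤n⇒m<n∨m≡n (Leads⇒level≤ (¬Div a) (classified a)))

theorem3p10 : (s : ℕ) → 1 ≤ s →
    let open ZeroDivisorGraph (ℤ/ (2 ^ s) [i,j,k]) in
    Σ[ θ ∈ GroupAction (Aut Γ-E) Reg ] Aut Γ ≅ (Reg ⋊[ θ ] Aut Γ-E)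
theorem3p10 (suc s) _ =
  Aut-Γ≅Reg⋊Aut-Γ-E {0ℓ} {0ℓ} (ℤ/ (2 ^ suc s) [i,j,k]) _≈?_ hasOtherTwinOrIsTop T levelling
  where
  open LipschitzModPowerOfTwo s
  instance
    Γ≡Γ : {Γ : Digraph 0ℓ 0ℓ 0ℓ} → Γ ≡ Γ
    Γ≡Γ = refl
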